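{- $t_2(n,2)=(1+o(1))\,n\log_2 n$ as $n\to\infty$.
   Context: All graphs are finite, simple and undirected. An $r$-colouring of a graph $G$ is a function $c:E(G)\to\{1,\dots,r\}$ (not necessarily proper). A path is rainbow if all its edges have distinct colours. Paths connecting two vertices are called disjoint if they are internally vertex-disjoint. For a $2$-connected graph $G$, a colouring is rainbow $2$-connected if every two vertices of $G$ are connected by two internally vertex-disjoint rainbow paths, and the rainbow $2$-connection number $rc_2(G)$ is the minimum number of colours in a rainbow $2$-connected colouring of $G$. For integers $n$ and $r\ge 1$, $t_2(n,r)$ denotes the minimum number of edges in a $2$-connected graph $G$ on $n$ vertices with $rc_2(G)\le r$. -}

module Defs where

open import Data.Nat using (ℕ; zero; suc; _+_; _*_; _∸_; _^_; _≤_; _<_)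
open import Data.Bool using (Bool; true; false; if_then_else_; _∧_)
open import Data.Fin using (Fin; toℕ)
open import Data.List using (List; []; _∷_; map; allFin; concatMap)
open import Data.Nat.ListAction using (sum)
open import Data.List.Membership.Propositional using (_∈_; _∉_)
open import Data.List.Relation.Unary.Unique.Propositional using (Unique)
open import Data.Product using (Σ; ∃; ∃-syntax; _×_; _,_)
open import Relation.Binary.PropositionalEquality using (_≡_; _≢_)
open import Relation.Nullary.Decidable using (⌊_⌋)
import Data.Nat as ℕ

record Graph (n : ℕ) : Set where
  field
    adj     : Fin n → Fin n → Bool
    adj-sym : ∀ i j → adj i j ≡ adj j i
    adj-irr : ∀ i → adj i i ≡ false
open Graph public

numEdges : ∀ {n} → Graph n → ℕ
numEdges {n} G =
  sum (concatMap (λ i → map (λ j →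
         if ⌊ toℕ i ℕ.<? toℕ j ⌋ ∧ adj G i j then 1 else 0) (allFin n)) (allFin n))

data Walk {n : ℕ} (G : Graph n) : Fin n → Fin n → List (Fin n) → Set where
  here  : ∀ u → Walk G u u (u ∷ [])
  step  : ∀ {u w v xs} → adj G u w ≡ true → Walk G w v xs → Walk G u v (u ∷ xs)

IsPath : ∀ {n} → Graph n → Fin n → Fin n → List (Fin n) → Set
IsPath G u v xs = Walk G u v xs × Unique xs

dropLast : ∀ {A : Set} → List A → List A
dropLast []           = []
dropLast (x ∷ [])     = []
dropLast (x ∷ y ∷ xs) = x ∷ dropLast (y ∷ xs)

interior : ∀ {A : Set} → List A → List A
interior []       = []
interior (x ∷ xs) = dropLast xs

IntDisjoint : ∀ {n} → List (Fin n) → List (Fin n) → Set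
IntDisjoint P Q = ∀ x → x ∈ interior P → x ∉ interior Q

Connected : ∀ {n} → Graph n → Set
Connected {n} G = ∀ (u v : Fin n) → ∃[ P ] IsPath G u v P

TwoConnected : ∀ {n} → Graph n → Set
TwoConnected {n} G =
  3 ≤ n × Connected G ×
  (∀ (w u v : Fin n) → u ≢ w → v ≢ w → ∃[ P ] (IsPath G u v P × w ∉ P))

-- An r-colouring of the edges (stored symmetrically on all pairs;
-- values on non-adjacent pairs are irrelevant).
record Colouring {n : ℕ} (G : Graph n) (r : ℕ) : Set where
  field
    col     : Fin n → Fin n → Fin r
    col-sym : ∀ i j → col i j ≡ col j i
open Colouring public

edgeColours : ∀ {n r} {G : Graph n} → Colouring G r → List (Fin n) → List (Fin r)
edgeColours c []           = []
edgeColours c (x ∷ [])     = []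
edgeColours c (x ∷ y ∷ xs) = col c x y ∷ edgeColours c (y ∷ xs)

IsRainbowPath : ∀ {n r} {G : Graph n} → Colouring G r → Fin n → Fin n → List (Fin n) → Set
IsRainbowPath {G = G} c u v P = IsPath G u v P × Unique (edgeColours c P)

RainbowTwoConnected : ∀ {n r} {G : Graph n} → Colouring G r → Set
RainbowTwoConnected {n} c =
  ∀ (u v : Fin n) → u ≢ v →
    ∃[ P ] ∃[ Q ] (IsRainbowPath c u v P × IsRainbowPath c u v Q × P ≢ Q × IntDisjoint P Q)

rc₂≤ : ∀ {n} → Graph n → ℕ → Set
rc₂≤ G r = Σ (Colouring G r) RainbowTwoConnected

IsT₂ : ℕ → ℕ → ℕ → Set
IsT₂ n r t =
  (∃[ G ] (TwoConnected {n} G × rc₂≤ G r × numEdges G ≡ t)) ×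
  (∀ (G : Graph n) → TwoConnected G → rc₂≤ G r → t ≤ numEdges G)

{-# OPTIONS --safe #-}

-- With two colours a rainbow path has at most two edges, so a colouring is rainbow 2-connected
-- iff every two vertices have two bicoloured paths of length 2 between them, or one such path
-- and an edge.
--
-- Lower bound. Let M be a small power of n. Only o(n) vertices have
-- degree above M (are high). Read the colours on the edges from a low vertex v to the high
-- vertices as a partial binary word, and choose a full word s. Two low vertices whose partial
-- words extend to s have no bicoloured path through a high vertex, so each is reached from the
-- other through a low one; hence at most 1 + M² low vertices extend to a given s. Averaging over s,
-- at most (1 + M²) 2^k low vertices have fewer than k high neighbours. With k = (1 - ε) log₂ n this is
-- o(n), so there are (1 - ε - o(1)) n log₂ n edges between low and high vertices.
--
-- Upper bound. Join every vertex to a core of log₂ n + O(1) vertices, with colours spelling the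
-- binary expansion of the vertex and a parity bit, so that distinct words differ at least twice.
--
-- The minimum t₂(n, 2) is found by exhaustive search.
module Submission where

open import Defs
open import Data.Bool as Bool using (Bool; true; false; if_then_else_; _∧_; _∨_; not)
open import Data.Bool.Properties using (∨-comm)
open import Data.Empty using (⊥; ⊥-elim)
open import Data.Fin using (Fin; zero; suc; toℕ; _≟_; finToFun; funToFin; combine; remQuot; inject≤; fromℕ<)
open import Data.Fin.Properties using (toℕ-injective; any?; all?; finToFun-funToFin; funToFin-finToFin; remQuot-combine; toℕ-inject≤; inject≤-injective; toℕ-fromℕ<; ¬∀⟶∃¬; toℕ<n)
open import Data.List using (List; []; _∷_; map; concatMap; tabulate; allFin)
import Data.List.Membership.DecPropositional as DecMembership
open import Data.List.Membership.Propositional using (_∈_; _∉_)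
open import Data.List.Relation.Unary.All using ([]; _∷_)
open import Data.List.Relation.Unary.AllPairs using ([]; _∷_)
open import Data.List.Relation.Unary.Any using (here; there)
open import Data.Maybe using (Maybe; just; nothing; is-just)
open import Data.Nat as ℕ using (ℕ; zero; suc; _+_; _*_; _∸_; _^_; _≤_; _<_; z≤n; s≤s; z<s; _<?_; _≤?_; NonZero)
open import Data.Nat.DivMod using (_/_; _%_; m/n*n≤m; m≡m%n+[m/n]*n; m%n<n)
open import Data.Nat.ListAction using () renaming (sum to sumᴸ)
open import Data.Nat.ListAction.Properties using (sum-++)
open import Data.Nat.Properties hiding (_≟_)
open import Algebra.Properties.Semiring.Sum +-*-semiring using (sum; sum-syntax; sum-cong-≗; ∑-distrib-+; ∑-comm; *-distribˡ-sum; *-distribʳ-sum)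
open import Data.Nat.Tactic.RingSolver using (solve-∀)
open import Data.Product using (∃-syntax; _×_; _,_; proj₁)
open import Data.Sum using (_⊎_; inj₁; inj₂)
open import Function using (_∘_)
open import Relation.Binary.Definitions using (tri<; tri≈; tri>)
open import Relation.Binary.PropositionalEquality using (_≡_; _≢_; refl; sym; trans; cong; cong₂; subst; subst₂; module ≡-Reasoning)
open import Relation.Nullary using (¬_; Dec; yes; no; contradiction)
open import Relation.Nullary.Decidable using (⌊_⌋; ¬?; _×-dec_; _⊎-dec_; _→-dec_; map′)

-- Powers of 2

⌊log₂⌋-bounds : ∀ n → ∃[ ℓ ] (2 ^ ℓ ≤ suc n × suc n < 2 ^ suc ℓ)
⌊log₂⌋-bounds zero = 0 , s≤s z≤n , s≤s (s≤s z≤n)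
⌊log₂⌋-bounds (suc n) with ⌊log₂⌋-bounds n
... | ℓ , lo , hi with suc (suc n) <? 2 ^ suc ℓ
...   | yes p = ℓ , m≤n⇒m≤1+n lo , p
...   | no ¬p = suc ℓ , ≮⇒≥ ¬p , ≤-<-trans hi (^-monoʳ-< 2 (s≤s (s≤s z≤n)) (n<1+n (suc ℓ)))

n<2^n : ∀ n → n < 2 ^ n
n<2^n zero = s≤s z≤n
n<2^n (suc n) = begin-strict
  suc n             ≤⟨ n<2^n n ⟩
  2 ^ n             <⟨ ^-monoʳ-< 2 (s≤s (s≤s z≤n)) (n<1+n n) ⟩
  2 ^ suc n         ∎
  where open ≤-Reasoning

2n≤2^n : ∀ n → 2 * n ≤ 2 ^ n
2n≤2^n zero = z≤n
2n≤2^n (suc n) = *-monoʳ-≤ 2 (n<2^n n)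

-- Split `q` as `C + r` with `r > C`: then `C ≤ 2 ^ C` and `suc q ≤ 2 * r ≤ 2 ^ r`, and these bounds
-- multiply to `2 ^ q`.
linear≤2^ : ∀ C q → suc (2 * C) ≤ q → C * suc q ≤ 2 ^ q
linear≤2^ C q 2C<q = begin
  C * suc q         ≤⟨ *-mono-≤ (<⇒≤ (n<2^n C)) (≤-trans 1+q≤2r (2n≤2^n r)) ⟩
  2 ^ C * 2 ^ r     ≡⟨ ^-distribˡ-+-* 2 C r ⟨
  2 ^ (C + r)       ≡⟨ cong (2 ^_) C+r≡q ⟩
  2 ^ q             ∎
  where
  open ≤-Reasoning
  r = q ∸ C
  C+r≡q : C + r ≡ q
  C+r≡q = m+[n∸m]≡n (≤-trans (m≤m+n C (C + 0)) (≤-trans (n≤1+n _) 2C<q))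
  C<r : suc C ≤ r
  C<r = +-cancelˡ-≤ C (suc C) r (begin
    C + suc C       ≡⟨ trans (+-suc C C) (cong (λ x → suc (C + x)) (sym (+-identityʳ C))) ⟩
    suc (2 * C)     ≤⟨ 2C<q ⟩
    q               ≡⟨ C+r≡q ⟨
    C + r           ∎)
  1+q≤2r : suc q ≤ 2 * r
  1+q≤2r = begin
    suc q           ≡⟨ cong suc C+r≡q ⟨
    suc C + r       ≤⟨ +-monoˡ-≤ r C<r ⟩
    r + r           ≡⟨ cong (r +_) (+-identityʳ r) ⟨
    2 * r           ∎

-- Finite sums

∑-mono-≤ : ∀ {n} {f g : Fin n → ℕ} → (∀ i → f i ≤ g i) → sum f ≤ sum g
∑-mono-≤ {zero}  f≤g = z≤n
∑-mono-≤ {suc n} f≤g = +-mono-≤ (f≤g zero) (∑-mono-≤ (f≤g ∘ suc))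

∑-const : ∀ n c → ∑[ i < n ] c ≡ n * c
∑-const zero    c = refl
∑-const (suc n) c = cong (c +_) (∑-const n c)

∑≡0⊎∃>0 : ∀ {n} (f : Fin n → ℕ) → sum f ≡ 0 ⊎ ∃[ i ] 0 < f i
∑≡0⊎∃>0 {zero} f = inj₁ refl
∑≡0⊎∃>0 {suc n} f with f zero in eq | ∑≡0⊎∃>0 (f ∘ suc)
... | suc _ | _ = inj₂ (zero , subst (0 <_) (sym eq) z<s)
... | zero  | inj₁ ∑≡0 = inj₁ ∑≡0
... | zero  | inj₂ (i , 0<fi) = inj₂ (suc i , 0<fi)

≤∑ : ∀ {n} (f : Fin n → ℕ) i → f i ≤ sum f
≤∑ f zero    = m≤m+n _ _
≤∑ f (suc i) = ≤-trans (≤∑ (f ∘ suc) i) (m≤n+m _ _)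

𝟙 : Bool → ℕ
𝟙 b = if b then 1 else 0

𝟙≤1 : ∀ b → 𝟙 b ≤ 1
𝟙≤1 true  = ≤-refl
𝟙≤1 false = z≤n

𝟙-∧ : ∀ a b → 𝟙 (a ∧ b) ≡ 𝟙 a * 𝟙 b
𝟙-∧ true  b = sym (+-identityʳ (𝟙 b))
𝟙-∧ false b = refl

-- Every off-diagonal summand is moved to the position above the diagonal.
∑∑-fold : ∀ {n} (f : Fin n → Fin n → ℕ) → (∀ i → f i i ≡ 0) →
  ∑[ i < n ] ∑[ j < n ] f i j ≡
  ∑[ i < n ] ∑[ j < n ] (𝟙 ⌊ toℕ i <? toℕ j ⌋ * (f i j + f j i))
∑∑-fold {n} f f≡0 = begin
  ∑[ i < n ] ∑[ j < n ] f i j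
    ≡⟨ sum-cong-≗ (λ i → sum-cong-≗ (split i)) ⟩
  ∑[ i < n ] ∑[ j < n ] (above i j * f i j + above j i * f i j)
    ≡⟨ sum-cong-≗ (λ i → ∑-distrib-+ (λ j → above i j * f i j) _) ⟩
  ∑[ i < n ] (∑[ j < n ] (above i j * f i j) + ∑[ j < n ] (above j i * f i j))
    ≡⟨ ∑-distrib-+ (λ i → ∑[ j < n ] (above i j * f i j)) _ ⟩
  ∑[ i < n ] ∑[ j < n ] (above i j * f i j) + ∑[ i < n ] ∑[ j < n ] (above j i * f i j)
    ≡⟨ cong (∑[ i < n ] ∑[ j < n ] (above i j * f i j) +_) (∑-comm (λ i j → above j i * f i j)) ⟩
  ∑[ i < n ] ∑[ j < n ] (above i j * f i j) + ∑[ i < n ] ∑[ j < n ] (above i j * f j i)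
    ≡⟨ ∑-distrib-+ (λ i → ∑[ j < n ] (above i j * f i j)) _ ⟨
  ∑[ i < n ] (∑[ j < n ] (above i j * f i j) + ∑[ j < n ] (above i j * f j i))
    ≡⟨ sum-cong-≗ (λ i → ∑-distrib-+ (λ j → above i j * f i j) _) ⟨
  ∑[ i < n ] ∑[ j < n ] (above i j * f i j + above i j * f j i)
    ≡⟨ sum-cong-≗ (λ i → sum-cong-≗ (λ j → *-distribˡ-+ (above i j) (f i j) (f j i))) ⟨
  ∑[ i < n ] ∑[ j < n ] (above i j * (f i j + f j i)) ∎
  where
  open ≡-Reasoning
  above : Fin n → Fin n → ℕ
  above i j = 𝟙 ⌊ toℕ i <? toℕ j ⌋
  split : ∀ i j → f i j ≡ above i j * f i j + above j i * f i j
  split i j with toℕ i <? toℕ j | toℕ j <? toℕ i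
  ... | yes i<j | yes j<i = contradiction j<i (<⇒≯ i<j)
  ... | yes i<j | no  j≮i = sym (trans (+-identityʳ _) (+-identityʳ _))
  ... | no  i≮j | yes j<i = sym (+-identityʳ _)
  ... | no  i≮j | no  j≮i with toℕ-injective (≤-antisym (≮⇒≥ j≮i) (≮⇒≥ i≮j))
  ...   | refl = f≡0 i

-- Binary words

Word : ℕ → ℕ → Set
Word r n = Fin n → Fin r

infixr 5 _∷ᵂ_
_∷ᵂ_ : ∀ {r n} → Fin r → Word r n → Word r (suc n)
(x ∷ᵂ w) zero    = x
(x ∷ᵂ w) (suc i) = w i

PartialWord : ℕ → Set
PartialWord n = Fin n → Maybe (Fin 2)

agree : Maybe (Fin 2) → Fin 2 → ℕ
agree nothing  _ = 1
agree (just x) y = 𝟙 ⌊ x ≟ y ⌋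

-- A 0/1 indicator written as a product over the letters, so that the factor of the first letter can
-- be split off inside sums.
extends : ∀ {n} → PartialWord n → Word 2 n → ℕ
extends {zero}  p s = 1
extends {suc n} p s = agree (p zero) (s zero) * extends (p ∘ suc) (s ∘ suc)

-- The number of full words extending `p`: an unspecified letter contributes a factor 2, a specified
-- one a factor 1.
extensions : ∀ {n} → PartialWord n → ℕ
extensions {zero}  p = 1
extensions {suc n} p = (agree (p zero) zero + agree (p zero) (suc zero)) * extensions (p ∘ suc)

support : ∀ {n} → PartialWord n → ℕ
support {n} p = ∑[ i < n ] 𝟙 (is-just (p i))

agree≤1 : ∀ m x → agree m x ≤ 1
agree≤1 nothing  x = ≤-refl
agree≤1 (just y) x = 𝟙≤1 ⌊ y ≟ x ⌋

extends≤1 : ∀ {n} (p : PartialWord n) s → extends p s ≤ 1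
extends≤1 {zero}  p s = ≤-refl
extends≤1 {suc n} p s = *-mono-≤ (agree≤1 (p zero) (s zero)) (extends≤1 (p ∘ suc) (s ∘ suc))

extends⇒agree : ∀ {n} (p : PartialWord n) s → extends p s ≢ 0 → ∀ {i x} → p i ≡ just x → x ≡ s i
extends⇒agree {suc n} p s ≢0 {zero} {x} eq with p zero
extends⇒agree {suc n} p s ≢0 {zero} {x} refl | just .x with x ≟ s zero
... | yes x≡s = x≡s
... | no  _   = contradiction refl ≢0
extends⇒agree {suc n} p s ≢0 {suc i} eq =
  extends⇒agree (p ∘ suc) (s ∘ suc)
    (λ ≡0 → ≢0 (trans (cong (agree (p zero) (s zero) *_) ≡0) (*-zeroʳ (agree (p zero) (s zero))))) eq

-- Every position contributes 2 in total: two choices and no support, or one choice and one unit of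
-- support.
extensions*2^support : ∀ {n} (p : PartialWord n) → extensions p * 2 ^ support p ≡ 2 ^ n
extensions*2^support {zero}  p = refl
extensions*2^support {suc n} p = begin
  c * e * 2 ^ (d + support q)     ≡⟨ cong (c * e *_) (^-distribˡ-+-* 2 d (support q)) ⟩
  c * e * (2 ^ d * 2 ^ support q) ≡⟨ [m*n]*[o*p]≡[m*o]*[n*p] c e (2 ^ d) _ ⟩
  c * 2 ^ d * (e * 2 ^ support q) ≡⟨ cong₂ _*_ (choices (p zero)) (extensions*2^support q) ⟩
  2 * 2 ^ n                       ∎
  where
  open ≡-Reasoning
  q = p ∘ suc
  c = agree (p zero) zero + agree (p zero) (suc zero)
  e = extensions q
  d = 𝟙 (is-just (p zero))
  choices : ∀ m → (agree m zero + agree m (suc zero)) * 2 ^ 𝟙 (is-just m) ≡ 2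
  choices nothing           = refl
  choices (just zero)       = refl
  choices (just (suc zero)) = refl

-- Double counting of the pairs (v, s) such that s extends p v.
∑-extensions≤ : ∀ {m} n (g : Fin m → ℕ) (p : Fin m → PartialWord n) K →
  (∀ s → ∑[ v < m ] (g v * extends (p v) s) ≤ K) →
  ∑[ v < m ] (g v * extensions (p v)) ≤ K * 2 ^ n
∑-extensions≤ zero g p K ≤K = ≤-trans (≤K λ ()) (≤-reflexive (sym (*-identityʳ K)))
∑-extensions≤ {m} (suc n) g p K ≤K = begin
  ∑[ v < m ] (g v * ((a v zero + a v (suc zero)) * e v))
    ≡⟨ sum-cong-≗ (λ v → regroup (g v) (a v zero) (a v (suc zero)) (e v)) ⟩
  ∑[ v < m ] (g v * a v zero * e v + g v * a v (suc zero) * e v)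
    ≡⟨ ∑-distrib-+ (λ v → g v * a v zero * e v) _ ⟩
  ∑[ v < m ] (g v * a v zero * e v) + ∑[ v < m ] (g v * a v (suc zero) * e v)
    ≤⟨ +-mono-≤ (half zero) (half (suc zero)) ⟩
  K * 2 ^ n + K * 2 ^ n
    ≡⟨ double K (2 ^ n) ⟩
  K * 2 ^ suc n ∎
  where
  open ≤-Reasoning
  a : Fin m → Fin 2 → ℕ
  a v = agree (p v zero)
  e : Fin m → ℕ
  e v = extensions (p v ∘ suc)
  regroup : ∀ g x y e → g * ((x + y) * e) ≡ g * x * e + g * y * e
  regroup = solve-∀
  double : ∀ x y → x * y + x * y ≡ x * (2 * y)
  double = solve-∀
  -- Fixing the first letter as `x` turns the weight `g v` into `g v * a v x`; general weights make
  -- the induction go through.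
  half : ∀ x → ∑[ v < m ] (g v * a v x * e v) ≤ K * 2 ^ n
  half x = ∑-extensions≤ n (λ v → g v * a v x) (λ v → p v ∘ suc) K λ s → begin
    ∑[ v < m ] (g v * a v x * extends (p v ∘ suc) s)
      ≡⟨ sum-cong-≗ (λ v → *-assoc (g v) (a v x) _) ⟩
    ∑[ v < m ] (g v * extends (p v) (x ∷ᵂ s))
      ≤⟨ ≤K (x ∷ᵂ s) ⟩
    K ∎

-- Rainbow connection with two colours

sum-map-tabulate : ∀ {n} {A : Set} (f : A → ℕ) (g : Fin n → A) → sumᴸ (map f (tabulate g)) ≡ sum (f ∘ g)
sum-map-tabulate {zero}  f g = refl
sum-map-tabulate {suc n} f g = cong (f (g zero) +_) (sum-map-tabulate f (g ∘ suc))

sum-concatMap-tabulate : ∀ {n} {A : Set} (f : A → List ℕ) (g : Fin n → A) →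
  sumᴸ (concatMap f (tabulate g)) ≡ ∑[ i < n ] sumᴸ (f (g i))
sum-concatMap-tabulate {zero}  f g = refl
sum-concatMap-tabulate {suc n} f g =
  trans (sum-++ (f (g zero)) _) (cong (sumᴸ (f (g zero)) +_) (sum-concatMap-tabulate f (g ∘ suc)))

Relation : ℕ → Set
Relation n = Fin n → Fin n → Bool

edgeCount : ∀ {n} → Relation n → ℕ
edgeCount {n} α = ∑[ i < n ] ∑[ j < n ] 𝟙 (⌊ toℕ i <? toℕ j ⌋ ∧ α i j)

numEdges≡edgeCount : ∀ {n} (G : Graph n) → numEdges G ≡ edgeCount (adj G)
numEdges≡edgeCount {n} G = trans
  (sum-concatMap-tabulate (λ i → map (isEdge i) (allFin n)) (λ i → i))
  (sum-cong-≗ {n} λ i → sum-map-tabulate (isEdge i) (λ j → j))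
  where
  isEdge : Fin n → Fin n → ℕ
  isEdge i j = 𝟙 (⌊ toℕ i <? toℕ j ⌋ ∧ adj G i j)

-- Links: rainbow connection by paths with at most two edges

module _ {n r} (α : Relation n) (χ : Fin n → Fin n → Fin r) where

  Bicoloured : Fin n → Fin n → Fin n → Set
  Bicoloured u v w = α u w ≡ true × α w v ≡ true × χ u w ≢ χ w v

  -- What two-coloured rainbow 2-connection amounts to for one pair; quantifying over vertices
  -- instead of paths makes it decidable.
  Linked : Fin n → Fin n → Set
  Linked u v = (α u v ≡ true × ∃[ w ] Bicoloured u v w)
             ⊎ (∃[ w ] ∃[ w′ ] (w ≢ w′ × Bicoloured u v w × Bicoloured u v w′))

  AllLinked : Set
  AllLinked = ∀ u v → u ≢ v → Linked u v

  linked⇒bicoloured : ∀ {u v} → Linked u v → ∃[ w ] Bicoloured u v w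
  linked⇒bicoloured (inj₁ (_ , w , b))         = w , b
  linked⇒bicoloured (inj₂ (w , _ , _ , b , _)) = w , b

  bicoloured? : ∀ u v w → Dec (Bicoloured u v w)
  bicoloured? u v w = (α u w Bool.≟ true) ×-dec (α w v Bool.≟ true) ×-dec ¬? (χ u w ≟ χ w v)

  linked? : ∀ u v → Dec (Linked u v)
  linked? u v = ((α u v Bool.≟ true) ×-dec any? (bicoloured? u v))
    ⊎-dec any? λ w → any? λ w′ → ¬? (w ≟ w′) ×-dec bicoloured? u v w ×-dec bicoloured? u v w′

  allLinked? : Dec AllLinked
  allLinked? = all? λ u → all? λ v → ¬? (u ≟ v) →-dec linked? u v

module _ {n r} {α α′ : Relation n} {χ χ′ : Fin n → Fin n → Fin r}
         (α≗ : ∀ i j → α i j ≡ α′ i j) (χ≗ : ∀ i j → χ i j ≡ χ′ i j) where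

  -- A relation or colouring recovered from its numerical code equals the original only pointwise,
  -- so links are transported along pointwise equality.
  bicoloured-resp : ∀ {u v w} → Bicoloured α χ u v w → Bicoloured α′ χ′ u v w
  bicoloured-resp {u} {v} {w} (uw , wv , ≢) =
    trans (sym (α≗ u w)) uw , trans (sym (α≗ w v)) wv ,
    λ eq → ≢ (trans (χ≗ u w) (trans eq (sym (χ≗ w v))))

  linked-resp : ∀ {u v} → Linked α χ u v → Linked α′ χ′ u v
  linked-resp {u} {v} (inj₁ (uv , w , b)) = inj₁ (trans (sym (α≗ u v)) uv , w , bicoloured-resp b)
  linked-resp (inj₂ (w , w′ , w≢w′ , b , b′)) =
    inj₂ (w , w′ , w≢w′ , bicoloured-resp b , bicoloured-resp b′)

module _ {n r} {α : Relation n} {χ : Fin n → Fin n → Fin r}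
         (α-sym : ∀ i j → α i j ≡ α j i) (χ-sym : ∀ i j → χ i j ≡ χ j i) where

  bicoloured-sym : ∀ {u v w} → Bicoloured α χ u v w → Bicoloured α χ v u w
  bicoloured-sym {u} {v} {w} (uw , wv , ≢) =
    trans (α-sym v w) wv , trans (α-sym w u) uw ,
    λ eq → ≢ (trans (χ-sym u w) (trans (sym eq) (χ-sym v w)))

  linked-sym : ∀ {u v} → Linked α χ u v → Linked α χ v u
  linked-sym {u} {v} (inj₁ (uv , w , b)) = inj₁ (trans (α-sym v u) uv , w , bicoloured-sym b)
  linked-sym (inj₂ (w , w′ , w≢w′ , b , b′)) = inj₂ (w , w′ , w≢w′ , bicoloured-sym b , bicoloured-sym b′)

true≢false : true ≢ false
true≢false ()

module _ {n r} (G : Graph n) (c : Colouring G r) where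

  adj⇒≢ : ∀ {i j} → adj G i j ≡ true → i ≢ j
  adj⇒≢ {i} e refl = true≢false (trans (sym e) (adj-irr G i))

  edge-path : ∀ {u v} → adj G u v ≡ true → IsRainbowPath c u v (u ∷ v ∷ [])
  edge-path e = (step e (here _) , (adj⇒≢ e ∷ []) ∷ [] ∷ []) , [] ∷ []

  bicoloured-path : ∀ {u v w} → u ≢ v → Bicoloured (adj G) (col c) u v w →
    IsRainbowPath c u v (u ∷ w ∷ v ∷ [])
  bicoloured-path u≢v (uw , wv , ≢) =
    (step uw (step wv (here _)) , (adj⇒≢ uw ∷ u≢v ∷ []) ∷ (adj⇒≢ wv ∷ []) ∷ [] ∷ []) ,
    (≢ ∷ []) ∷ [] ∷ []

  linked⇒rainbow : AllLinked (adj G) (col c) → RainbowTwoConnected c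
  linked⇒rainbow linked u v u≢v with linked u v u≢v
  ... | inj₁ (uv , w , b) =
    u ∷ v ∷ [] , u ∷ w ∷ v ∷ [] , edge-path uv , bicoloured-path u≢v b , (λ ()) , λ _ ()
  ... | inj₂ (w , w′ , w≢w′ , b , b′) =
    u ∷ w ∷ v ∷ [] , u ∷ w′ ∷ v ∷ [] , bicoloured-path u≢v b , bicoloured-path u≢v b′ ,
    (λ { refl → w≢w′ refl }) , λ { _ (here refl) (here refl) → w≢w′ refl }

  -- A vertex other than the two ends that lies on one of the disjoint paths is interior to it,
  -- hence misses the other path.
  rainbow⇒twoConnected : 3 ≤ n → RainbowTwoConnected c → TwoConnected G
  rainbow⇒twoConnected 3≤n rainbow = 3≤n , connected , avoiding
    where
    trivial : ∀ u → IsPath G u u (u ∷ [])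
    trivial u = here u , [] ∷ []
    connected : Connected G
    connected u v with u ≟ v
    ... | yes refl = u ∷ [] , trivial u
    ... | no  u≢v with rainbow u v u≢v
    ...   | P , _ , (path , _) , _ = P , path
    ∈-interior : ∀ {u v w P} → Walk G u v P → w ≢ u → w ≢ v → w ∈ P → w ∈ interior P
    ∈-interior (here _) w≢u w≢v (here w≡u) = ⊥-elim (w≢u w≡u)
    ∈-interior (step _ walk) w≢u w≢v (here w≡u) = ⊥-elim (w≢u w≡u)
    ∈-interior (step _ walk) w≢u w≢v (there w∈P) = ∈-dropLast walk w≢v w∈P
      where
      ∈-dropLast : ∀ {u v w P} → Walk G u v P → w ≢ v → w ∈ P → w ∈ dropLast P
      ∈-dropLast (here _) w≢v (here w≡v) = ⊥-elim (w≢v w≡v)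
      ∈-dropLast (step _ (here _)) w≢v (here refl) = here refl
      ∈-dropLast (step _ (step _ _)) w≢v (here refl) = here refl
      ∈-dropLast (step _ (here _)) w≢v (there (here w≡v)) = ⊥-elim (w≢v w≡v)
      ∈-dropLast (step _ walk@(step _ _)) w≢v (there w∈P) = there (∈-dropLast walk w≢v w∈P)
    open DecMembership (_≟_ {n}) using (_∈?_)
    avoiding : ∀ w u v → u ≢ w → v ≢ w → ∃[ P ] (IsPath G u v P × w ∉ P)
    avoiding w u v u≢w v≢w with u ≟ v
    ... | yes refl = u ∷ [] , trivial u , λ { (here w≡u) → u≢w (sym w≡u) }
    ... | no  u≢v with rainbow u v u≢v
    ...   | P , Q , (pathP , _) , (pathQ , _) , _ , disjoint with w ∈? P
    ...     | no  w∉P = P , pathP , w∉P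
    ...     | yes w∈P = Q , pathQ , λ w∈Q → disjoint w
      (∈-interior (proj₁ pathP) (u≢w ∘ sym) (v≢w ∘ sym) w∈P)
      (∈-interior (proj₁ pathQ) (u≢w ∘ sym) (v≢w ∘ sym) w∈Q)

module _ {n} (G : Graph n) (c : Colouring G 2) where

  data ShortPath (u v : Fin n) : List (Fin n) → Set where
    direct : adj G u v ≡ true → ShortPath u v (u ∷ v ∷ [])
    via    : ∀ w → Bicoloured (adj G) (col c) u v w → ShortPath u v (u ∷ w ∷ v ∷ [])

  no-three-colours : ∀ (x y z : Fin 2) → x ≢ y → x ≢ z → y ≢ z → ⊥
  no-three-colours zero       zero       _          x≢y _   _   = x≢y refl
  no-three-colours zero       (suc zero) zero       _   x≢z _   = x≢z refl
  no-three-colours zero       (suc zero) (suc zero) _   _   y≢z = y≢z refl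
  no-three-colours (suc zero) (suc zero) _          x≢y _   _   = x≢y refl
  no-three-colours (suc zero) zero       (suc zero) _   x≢z _   = x≢z refl
  no-three-colours (suc zero) zero       zero       _   _   y≢z = y≢z refl

  shortPath : ∀ {u v P} → u ≢ v → IsRainbowPath c u v P → ShortPath u v P
  shortPath u≢v ((here _ , _) , _) = ⊥-elim (u≢v refl)
  shortPath u≢v ((step e (here _) , _) , _) = direct e
  shortPath u≢v ((step e (step f (here _)) , _) , (≢ ∷ []) ∷ _) = via _ (e , f , ≢)
  -- A third edge would need a third colour. The rest of the walk is matched because `edgeColours`
  -- yields the third colour only once the next vertex is visible.
  shortPath u≢v ((step e (step f (step g (here _))) , _) , (p ∷ q ∷ _) ∷ (r ∷ _) ∷ _) =
    ⊥-elim (no-three-colours _ _ _ p q r)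
  shortPath u≢v ((step e (step f (step g (step _ _))) , _) , (p ∷ q ∷ _) ∷ (r ∷ _) ∷ _) =
    ⊥-elim (no-three-colours _ _ _ p q r)

  rainbow⇒linked : RainbowTwoConnected c → AllLinked (adj G) (col c)
  rainbow⇒linked rainbow u v u≢v with rainbow u v u≢v
  ... | _ , _ , P-path , Q-path , P≢Q , _ with shortPath u≢v P-path | shortPath u≢v Q-path
  ...   | direct _  | direct _   = ⊥-elim (P≢Q refl)
  ...   | direct uv | via w b    = inj₁ (uv , w , b)
  ...   | via w b   | direct uv  = inj₁ (uv , w , b)
  ...   | via w b   | via w′ b′  = inj₂ (w , w′ , (λ { refl → P≢Q refl }) , b , b′)

-- Existence of the minimum

least : ∀ {P : ℕ → Set} → (∀ t → Dec (P t)) → ∀ m → P m → ∃[ t ] (P t × t ≤ m × (∀ s → P s → t ≤ s))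
least {P} P? m Pm with search m
  where
  search : ∀ m → (∃[ t ] (P t × t < m × (∀ s → P s → t ≤ s))) ⊎ (∀ s → P s → m ≤ s)
  search zero = inj₂ λ _ _ → z≤n
  search (suc m) with search m
  ... | inj₁ (t , Pt , t<m , min) = inj₁ (t , Pt , m<n⇒m<1+n t<m , min)
  ... | inj₂ below with P? m
  ...   | yes Pm = inj₁ (m , Pm , ≤-refl , below)
  ...   | no ¬Pm = inj₂ λ s Ps → ≤∧≢⇒< (below s Ps) λ { refl → ¬Pm Ps }
... | inj₁ (t , Pt , t<m , min) = t , Pt , <⇒≤ t<m , min
... | inj₂ below = m , Pm , ≤-refl , below


-- Attainability in terms of bare functions and without paths, so that it can be checked; for
-- `3 ≤ n`, 2-connectedness is recovered from the links.
Admissible : ∀ {n} → Relation n → (Fin n → Fin n → Fin 2) → ℕ → Set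
Admissible α χ t =
  (∀ i j → α i j ≡ α j i) × (∀ i → α i i ≡ false) × (∀ i j → χ i j ≡ χ j i) ×
  AllLinked α χ × edgeCount α ≡ t

admissible? : ∀ {n} (α : Relation n) (χ : Fin n → Fin n → Fin 2) t → Dec (Admissible α χ t)
admissible? α χ t =
  (all? λ i → all? λ j → α i j Bool.≟ α j i) ×-dec (all? λ i → α i i Bool.≟ false) ×-dec
  (all? λ i → all? λ j → χ i j ≟ χ j i) ×-dec allLinked? α χ ×-dec (edgeCount α ℕ.≟ t)

admissible-resp : ∀ {n} {α α′ : Relation n} {χ χ′ : Fin n → Fin n → Fin 2} {t} →
  (∀ i j → α i j ≡ α′ i j) → (∀ i j → χ i j ≡ χ′ i j) → Admissible α χ t → Admissible α′ χ′ t
admissible-resp α≗ χ≗ (α-sym , α-irr , χ-sym , linked , count) =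
  (λ i j → trans (sym (α≗ i j)) (trans (α-sym i j) (α≗ j i))) ,
  (λ i → trans (sym (α≗ i i)) (α-irr i)) ,
  (λ i j → trans (sym (χ≗ i j)) (trans (χ-sym i j) (χ≗ j i))) ,
  (λ u v u≢v → linked-resp α≗ χ≗ (linked u v u≢v)) ,
  trans (sum-cong-≗ λ i → sum-cong-≗ λ j → cong (λ b → 𝟙 (⌊ toℕ i <? toℕ j ⌋ ∧ b)) (sym (α≗ i j))) count

Attainable : ℕ → ℕ → Set
Attainable n t = ∃[ G ] (TwoConnected {n} G × rc₂≤ G 2 × numEdges G ≡ t)

attainable⇒admissible : ∀ {n t} → Attainable n t → ∃[ α ] ∃[ χ ] Admissible {n} α χ t
attainable⇒admissible (G , _ , (c , rainbow) , count) =
  adj G , col c , adj-sym G , adj-irr G , col-sym c , rainbow⇒linked G c rainbow ,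
  trans (sym (numEdges≡edgeCount G)) count

admissible⇒attainable : ∀ {n t} {α : Relation n} {χ : Fin n → Fin n → Fin 2} →
  3 ≤ n → Admissible α χ t → Attainable n t
admissible⇒attainable {n} {α = α} {χ} 3≤n (α-sym , α-irr , χ-sym , linked , count) =
  G , rainbow⇒twoConnected G c 3≤n rainbow , (c , rainbow) , trans (numEdges≡edgeCount G) count
  where
  G : Graph n
  G = record { adj = α ; adj-sym = α-sym ; adj-irr = α-irr }
  c : Colouring G 2
  c = record { col = χ ; col-sym = χ-sym }
  rainbow : RainbowTwoConnected c
  rainbow = linked⇒rainbow G c linked

-- Binary functions on `Fin n` are numbered by `Fin (r ^ (n * n))`, which turns the search over
-- graphs and colourings into a finite one.
decode : ∀ {n r} → Fin (r ^ (n * n)) → Fin n → Fin n → Fin r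
decode k i j = finToFun k (combine i j)

encode : ∀ {n r} → (Fin n → Fin n → Fin r) → Fin (r ^ (n * n))
encode {n} f = funToFin (λ k → let i , j = remQuot n k in f i j)

decode-encode : ∀ {n r} (f : Fin n → Fin n → Fin r) i j → decode (encode f) i j ≡ f i j
decode-encode {n} f i j = trans (finToFun-funToFin _ (combine i j))
  (cong (λ (i , j) → f i j) (remQuot-combine {n} {n} i j))

attainable? : ∀ {n} → 3 ≤ n → ∀ t → Dec (Attainable n t)
attainable? {n} 3≤n t = map′ to from
  (any? λ a → any? λ c → admissible? (relation a) (decode c) t)
  where
  toBool : Fin 2 → Bool
  toBool zero       = false
  toBool (suc zero) = true
  fromBool : Bool → Fin 2
  fromBool false = zero
  fromBool true  = suc zero
  toBool-fromBool : ∀ b → toBool (fromBool b) ≡ b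
  toBool-fromBool false = refl
  toBool-fromBool true  = refl
  relation : Fin (2 ^ (n * n)) → Relation n
  relation a i j = toBool (decode a i j)
  to : (∃[ a ] ∃[ c ] Admissible (relation a) (decode c) t) → Attainable n t
  to (_ , _ , adm) = admissible⇒attainable 3≤n adm
  from : Attainable n t → ∃[ a ] ∃[ c ] Admissible (relation a) (decode c) t
  from att with attainable⇒admissible att
  ... | α , χ , adm = encode (λ i j → fromBool (α i j)) , encode χ , admissible-resp
    (λ i j → sym (trans (cong toBool (decode-encode _ i j)) (toBool-fromBool (α i j))))
    (λ i j → sym (decode-encode χ i j)) adm

-- Any one attainable value bounds the search, and `t ≤ m` passes the edge count of a construction
-- on to the minimum.
t₂-exists : ∀ {n m} → 3 ≤ n → Attainable n m → ∃[ t ] (IsT₂ n 2 t × t ≤ m)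
t₂-exists {n} {m} 3≤n att with least (attainable? 3≤n) m att
... | t , att-t , t≤m , minimal =
  t , (att-t , λ G G2 rc → minimal (numEdges G) (G , G2 , rc , refl)) , t≤m

-- Lower bound

*-𝟙-≤ : ∀ b {m k} → (b ≡ true → m ≤ k) → 𝟙 b * m ≤ k
*-𝟙-≤ true  m≤k = ≤-trans (≤-reflexive (*-identityˡ _)) (m≤k refl)
*-𝟙-≤ false m≤k = z≤n

∑-𝟙≟ : ∀ {n} (u : Fin n) → ∑[ v < n ] 𝟙 ⌊ u ≟ v ⌋ ≡ 1
∑-𝟙≟ {suc n} zero = cong suc (trans (∑-const n 0) (*-zeroʳ n))
∑-𝟙≟ {suc n} (suc u) = trans (sum-cong-≗ {n} shift) (∑-𝟙≟ u)
  where
  shift : ∀ v → 𝟙 ⌊ suc u ≟ suc v ⌋ ≡ 𝟙 ⌊ u ≟ v ⌋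
  shift v with u ≟ v
  ... | yes _ = refl
  ... | no  _ = refl

module _ {n} (α : Relation n) where

  degree : Fin n → ℕ
  degree v = ∑[ w < n ] 𝟙 (α v w)

module _ {n} {α : Relation n} (α-sym : ∀ i j → α i j ≡ α j i) (α-irr : ∀ i → α i i ≡ false) where

  handshake : ∑[ v < n ] degree α v ≡ 2 * edgeCount α
  handshake = begin
    ∑[ i < n ] ∑[ j < n ] 𝟙 (α i j)
      ≡⟨ ∑∑-fold (λ i j → 𝟙 (α i j)) (λ i → cong 𝟙 (α-irr i)) ⟩
    ∑[ i < n ] ∑[ j < n ] (𝟙 ⌊ toℕ i <? toℕ j ⌋ * (𝟙 (α i j) + 𝟙 (α j i)))
      ≡⟨ sum-cong-≗ {n} (λ i → sum-cong-≗ {n} (double i)) ⟩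
    ∑[ i < n ] ∑[ j < n ] (2 * 𝟙 (⌊ toℕ i <? toℕ j ⌋ ∧ α i j))
      ≡⟨ sum-cong-≗ {n} (λ i → *-distribˡ-sum {n} 2 _) ⟨
    ∑[ i < n ] (2 * ∑[ j < n ] 𝟙 (⌊ toℕ i <? toℕ j ⌋ ∧ α i j))
      ≡⟨ *-distribˡ-sum {n} 2 _ ⟨
    2 * edgeCount α ∎
    where
    open ≡-Reasoning
    double : ∀ i j → 𝟙 ⌊ toℕ i <? toℕ j ⌋ * (𝟙 (α i j) + 𝟙 (α j i)) ≡ 2 * 𝟙 (⌊ toℕ i <? toℕ j ⌋ ∧ α i j)
    double i j rewrite sym (α-sym i j) | 𝟙-∧ ⌊ toℕ i <? toℕ j ⌋ (α i j) = algebra (𝟙 ⌊ toℕ i <? toℕ j ⌋) (𝟙 (α i j))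
      where
      algebra : ∀ x y → x * (y + y) ≡ 2 * (x * y)
      algebra = solve-∀

  -- After folding over the diagonal, each edge is counted at most once: its two orientations cannot
  -- both lead out of `A`.
  crossing-edges : ∀ (A : Fin n → Bool) →
    ∑[ i < n ] (𝟙 (A i) * ∑[ j < n ] (𝟙 (not (A j)) * 𝟙 (α i j))) ≤ edgeCount α
  crossing-edges A = begin
    ∑[ i < n ] (𝟙 (A i) * ∑[ j < n ] (𝟙 (not (A j)) * 𝟙 (α i j)))
      ≡⟨ sum-cong-≗ {n} (λ i → *-distribˡ-sum {n} (𝟙 (A i)) _) ⟩
    ∑[ i < n ] ∑[ j < n ] cross i j
      ≡⟨ ∑∑-fold cross (λ i → diagonal (A i) (𝟙 (α i i))) ⟩
    ∑[ i < n ] ∑[ j < n ] (𝟙 ⌊ toℕ i <? toℕ j ⌋ * (cross i j + cross j i))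
      ≤⟨ ∑-mono-≤ {n} (λ i → ∑-mono-≤ {n} (bound i)) ⟩
    edgeCount α ∎
    where
    open ≤-Reasoning
    cross : Fin n → Fin n → ℕ
    cross i j = 𝟙 (A i) * (𝟙 (not (A j)) * 𝟙 (α i j))
    diagonal : ∀ a x → 𝟙 a * (𝟙 (not a) * x) ≡ 0
    diagonal true  x = refl
    diagonal false x = refl
    exclusive : ∀ a b x → 𝟙 a * (𝟙 (not b) * x) + 𝟙 b * (𝟙 (not a) * x) ≤ x
    exclusive true  true  x = z≤n
    exclusive true  false x = ≤-reflexive (trans (+-identityʳ _) (trans (*-identityˡ _) (*-identityˡ x)))
    exclusive false true  x = ≤-reflexive (trans (*-identityˡ _) (*-identityˡ x))
    exclusive false false x = z≤n
    bound : ∀ i j → 𝟙 ⌊ toℕ i <? toℕ j ⌋ * (cross i j + cross j i) ≤ 𝟙 (⌊ toℕ i <? toℕ j ⌋ ∧ α i j)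
    bound i j rewrite sym (α-sym i j) | 𝟙-∧ ⌊ toℕ i <? toℕ j ⌋ (α i j) =
      *-monoʳ-≤ (𝟙 ⌊ toℕ i <? toℕ j ⌋) (exclusive (A i) (A j) (𝟙 (α i j)))

  module _ {χ : Fin n → Fin n → Fin 2} (χ-sym : ∀ i j → χ i j ≡ χ j i) (linked : AllLinked α χ)
           (M : ℕ) where

    low : Fin n → Bool
    low v = ⌊ degree α v ≤? M ⌋

    -- Positions range over all `n` vertices, so that the words of different vertices can be
    -- compared; only high neighbours carry a letter.
    highColours : Fin n → PartialWord n
    highColours v w = if not (low w) ∧ α v w then just (χ v w) else nothing

    low⇒degree≤ : ∀ v → low v ≡ true → degree α v ≤ M
    low⇒degree≤ v eq with degree α v ≤? M
    ... | yes d≤M = d≤M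

    -- Two low vertices extended by the same word are not linked through a high vertex,
    -- so each is reached from the other by a path of length 2 through a low vertex.
    survivors≤ : ∀ s → ∑[ v < n ] (𝟙 (low v) * extends (highColours v) s) ≤ 1 + M * M
    survivors≤ s with ∑≡0⊎∃>0 {n} (λ v → 𝟙 (low v) * extends (highColours v) s)
    ... | inj₁ ∑≡0 = subst (_≤ 1 + M * M) (sym ∑≡0) z≤n
    ... | inj₂ (u , 0<u) = begin
      ∑[ v < n ] survives v
        ≤⟨ ∑-mono-≤ {n} close ⟩
      ∑[ v < n ] (𝟙 ⌊ u ≟ v ⌋ + ∑[ w < n ] (𝟙 (α u w) * (𝟙 (low w) * 𝟙 (α w v))))
        ≡⟨ ∑-distrib-+ {n} (λ v → 𝟙 ⌊ u ≟ v ⌋) _ ⟩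
      ∑[ v < n ] 𝟙 ⌊ u ≟ v ⌋ + ∑[ v < n ] ∑[ w < n ] (𝟙 (α u w) * (𝟙 (low w) * 𝟙 (α w v)))
        ≡⟨ cong₂ _+_ (∑-𝟙≟ u) (∑-comm {n} {n} λ v w → 𝟙 (α u w) * (𝟙 (low w) * 𝟙 (α w v))) ⟩
      1 + ∑[ w < n ] ∑[ v < n ] (𝟙 (α u w) * (𝟙 (low w) * 𝟙 (α w v)))
        ≡⟨ cong suc (sum-cong-≗ {n} λ w → pull (𝟙 (α u w)) (𝟙 (low w)) (λ v → 𝟙 (α w v))) ⟨
      1 + ∑[ w < n ] (𝟙 (α u w) * (𝟙 (low w) * degree α w))
        -- Walks of length 2 from `u` with a low middle vertex: at most `M` ends for each middle
        -- vertex, and at most `M` middle vertices since `u` is low.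
        ≤⟨ s≤s (∑-mono-≤ {n} λ w → *-monoʳ-≤ (𝟙 (α u w)) (*-𝟙-≤ (low w) (low⇒degree≤ w))) ⟩
      1 + ∑[ w < n ] (𝟙 (α u w) * M)
        ≡⟨ cong suc (*-distribʳ-sum {n} M (λ w → 𝟙 (α u w))) ⟨
      1 + degree α u * M
        ≤⟨ s≤s (*-monoˡ-≤ M (low⇒degree≤ u (low-survivor u 0<u))) ⟩
      1 + M * M ∎
      where
      open ≤-Reasoning
      survives : Fin n → ℕ
      survives v = 𝟙 (low v) * extends (highColours v) s
      pull : ∀ x y (f : Fin n → ℕ) → x * (y * sum f) ≡ ∑[ v < n ] (x * (y * f v))
      pull x y f = trans (cong (x *_) (*-distribˡ-sum {n} y f)) (*-distribˡ-sum {n} x _)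
      low-survivor : ∀ v → 0 < survives v → low v ≡ true
      low-survivor v 0<v with low v
      ... | true = refl
      extends≢0 : ∀ v → 0 < survives v → extends (highColours v) s ≢ 0
      extends≢0 v 0<v ≡0 = <⇒≢ 0<v (sym (trans (cong (𝟙 (low v) *_) ≡0) (*-zeroʳ (𝟙 (low v)))))
      survives≤1 : ∀ v → survives v ≤ 1
      survives≤1 v = *-mono-≤ (𝟙≤1 (low v)) (extends≤1 (highColours v) s)
      highColour : ∀ v w → low w ≡ false → α v w ≡ true → highColours v w ≡ just (χ v w)
      highColour v w high vw rewrite high | vw = refl
      through-low : ∀ v → 0 < survives v → ∀ w → Bicoloured α χ u v w → low w ≡ true
      through-low v 0<v w (uw , wv , ≢) with low w in eq
      ... | true  = refl
      -- At a high `w` both partial words carry the letter `s w`, so the two edges of the path have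
      -- the same colour.
      ... | false = contradiction
        (trans (extends⇒agree (highColours u) s (extends≢0 u 0<u) (highColour u w eq uw))
          (trans (sym (extends⇒agree (highColours v) s (extends≢0 v 0<v)
            (highColour v w eq (trans (α-sym v w) wv)))) (χ-sym v w))) ≢
      close : ∀ v → survives v ≤ 𝟙 ⌊ u ≟ v ⌋ + ∑[ w < n ] (𝟙 (α u w) * (𝟙 (low w) * 𝟙 (α w v)))
      close v with u ≟ v
      ... | yes _ = ≤-trans (survives≤1 v) (s≤s z≤n)
      ... | no u≢v with 0 <? survives v
      ...   | no ≮0 = ≤-trans (≮⇒≥ ≮0) z≤n
      ...   | yes 0<v with linked⇒bicoloured α χ (linked u v u≢v)
      ...     | w , bi@(uw , wv , _) = begin
        survives v ≤⟨ survives≤1 v ⟩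
        1          ≡⟨ cong₂ _*_ (cong 𝟙 uw) (cong₂ _*_ (cong 𝟙 (through-low v 0<v w bi)) (cong 𝟙 wv)) ⟨
        𝟙 (α u w) * (𝟙 (low w) * 𝟙 (α w v))
                   ≤⟨ ≤∑ {n} (λ w → 𝟙 (α u w) * (𝟙 (low w) * 𝟙 (α w v))) w ⟩
        ∑[ w < n ] (𝟙 (α u w) * (𝟙 (low w) * 𝟙 (α w v))) ∎

    highDegree : Fin n → ℕ
    highDegree v = ∑[ w < n ] (𝟙 (not (low w)) * 𝟙 (α v w))

    support-highColours : ∀ v → support (highColours v) ≡ highDegree v
    support-highColours v = sum-cong-≗ {n} pointwise
      where
      pointwise : ∀ w → 𝟙 (is-just (highColours v w)) ≡ 𝟙 (not (low w)) * 𝟙 (α v w)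
      pointwise w with not (low w) | α v w
      ... | true  | true  = refl
      ... | true  | false = refl
      ... | false | true  = refl
      ... | false | false = refl

    poor : ℕ → Fin n → Bool
    poor k v = low v ∧ ⌊ highDegree v <? k ⌋

    -- A poor vertex has at least `2 ^ (n ∸ k)` extensions when `k ≤ n`, while double counting
    -- bounds the total by `(1 + M * M) * 2 ^ n`. Multiplying by `2 ^ k` avoids the subtraction.
    few-poor : ∀ k → ∑[ v < n ] 𝟙 (poor k v) ≤ (1 + M * M) * 2 ^ k
    few-poor k = *-cancelʳ-≤ _ _ (2 ^ n) {{m^n≢0 2 n}} (begin
      ∑[ v < n ] 𝟙 (poor k v) * 2 ^ n
        ≡⟨ *-distribʳ-sum {n} (2 ^ n) _ ⟩
      ∑[ v < n ] (𝟙 (poor k v) * 2 ^ n)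
        ≤⟨ ∑-mono-≤ {n} many-extensions ⟩
      ∑[ v < n ] (𝟙 (low v) * extensions (highColours v) * 2 ^ k)
        ≡⟨ *-distribʳ-sum {n} (2 ^ k) _ ⟨
      ∑[ v < n ] (𝟙 (low v) * extensions (highColours v)) * 2 ^ k
        ≤⟨ *-monoˡ-≤ (2 ^ k) (∑-extensions≤ n (λ v → 𝟙 (low v)) highColours (1 + M * M) survivors≤) ⟩
      (1 + M * M) * 2 ^ n * 2 ^ k
        ≡⟨ swap (1 + M * M) (2 ^ n) (2 ^ k) ⟩
      (1 + M * M) * 2 ^ k * 2 ^ n ∎)
      where
      open ≤-Reasoning
      swap : ∀ x y z → x * y * z ≡ x * z * y
      swap = solve-∀
      many-extensions : ∀ v → 𝟙 (poor k v) * 2 ^ n ≤ 𝟙 (low v) * extensions (highColours v) * 2 ^ k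
      many-extensions v with low v | highDegree v <? k
      ... | false | _      = z≤n
      ... | true  | no _   = z≤n
      ... | true  | yes d<k = begin
        1 * 2 ^ n      ≡⟨ *-identityˡ (2 ^ n) ⟩
        2 ^ n          ≡⟨ extensions*2^support (highColours v) ⟨
        extensions (highColours v) * 2 ^ support (highColours v)
                       ≤⟨ *-monoʳ-≤ (extensions (highColours v)) (^-monoʳ-≤ 2
                            (≤-trans (≤-reflexive (support-highColours v)) (<⇒≤ d<k))) ⟩
        extensions (highColours v) * 2 ^ k
                       ≡⟨ cong (_* 2 ^ k) (*-identityˡ (extensions (highColours v))) ⟨
        1 * extensions (highColours v) * 2 ^ k ∎

    -- Each high vertex contributes more than `M` to the degree sum, which the handshake lemma
    -- evaluates.
    few-high : ∑[ v < n ] 𝟙 (not (low v)) * M ≤ 2 * edgeCount α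
    few-high = begin
      ∑[ v < n ] 𝟙 (not (low v)) * M   ≡⟨ *-distribʳ-sum {n} M _ ⟩
      ∑[ v < n ] (𝟙 (not (low v)) * M) ≤⟨ ∑-mono-≤ {n} bound ⟩
      ∑[ v < n ] degree α v            ≡⟨ handshake ⟩
      2 * edgeCount α                  ∎
      where
      open ≤-Reasoning
      bound : ∀ v → 𝟙 (not (low v)) * M ≤ degree α v
      bound v with degree α v ≤? M
      ... | yes _   = z≤n
      ... | no  d≰M = ≤-trans (≤-reflexive (*-identityˡ M)) (<⇒≤ (≰⇒> d≰M))

    -- Every vertex is high, poor, or low with at least `k` high neighbours. Multiplied by `M`,
    -- these classes cost `2 * E * k`, `k * n` and `E * M`, the last by counting low-high edges.
    edgeCount-bound : ∀ k → (1 + M * M) * 2 ^ k * M ≤ n →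
      k * n * M ≤ edgeCount α * (M + 2 * k) + k * n
    edgeCount-bound k small = begin
      k * n * M
        ≡⟨ cong (_* M) (trans (*-comm k n) (sym (∑-const n k))) ⟩
      ∑[ v < n ] k * M
        ≤⟨ *-monoˡ-≤ M (∑-mono-≤ {n} classify) ⟩
      ∑[ v < n ] (𝟙 (not (low v)) * k + 𝟙 (poor k v) * k + 𝟙 (low v) * highDegree v) * M
        ≡⟨ cong (_* M) (trans (∑-distrib-+ {n} (λ v → 𝟙 (not (low v)) * k + 𝟙 (poor k v) * k) _)
             (cong (_+ S) (trans (∑-distrib-+ {n} (λ v → 𝟙 (not (low v)) * k) _)
               (cong₂ _+_ (sym (*-distribʳ-sum {n} k _)) (sym (*-distribʳ-sum {n} k _)))))) ⟩
      (H * k + Y * k + S) * M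
        ≡⟨ expand H Y S k M ⟩
      H * M * k + k * (Y * M) + S * M
        ≤⟨ +-mono-≤ (+-mono-≤ (*-monoˡ-≤ k few-high)
             (*-monoʳ-≤ k (≤-trans (*-monoˡ-≤ M (few-poor k)) small)))
             (*-monoˡ-≤ M (crossing-edges low)) ⟩
      2 * E * k + k * n + E * M
        ≡⟨ collect E k n M ⟩
      E * (M + 2 * k) + k * n ∎
      where
      open ≤-Reasoning
      E = edgeCount α
      H = ∑[ v < n ] 𝟙 (not (low v))
      Y = ∑[ v < n ] 𝟙 (poor k v)
      S = ∑[ v < n ] (𝟙 (low v) * highDegree v)
      expand : ∀ H Y S k M → (H * k + Y * k + S) * M ≡ H * M * k + k * (Y * M) + S * M
      expand = solve-∀
      collect : ∀ E k n M → 2 * E * k + k * n + E * M ≡ E * (M + 2 * k) + k * n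
      collect = solve-∀
      classify : ∀ v → k ≤ 𝟙 (not (low v)) * k + 𝟙 (poor k v) * k + 𝟙 (low v) * highDegree v
      classify v with low v | highDegree v <? k
      ... | false | _       = ≤-reflexive (sym (trans (+-identityʳ _) (trans (+-identityʳ _) (+-identityʳ k))))
      ... | true  | yes _   = ≤-trans (≤-reflexive (sym (*-identityˡ k))) (m≤m+n _ _)
      ... | true  | no  d≮k = ≤-trans (≮⇒≥ d≮k) (≤-reflexive (sym (*-identityˡ _)))

-- Upper bound

infixl 6 _⊕_
_⊕_ : Fin 2 → Fin 2 → Fin 2
x        ⊕ zero     = x
zero     ⊕ suc zero = suc zero
suc zero ⊕ suc zero = zero

⊕-cancelˡ : ∀ x {y z} → x ⊕ y ≡ x ⊕ z → y ≡ z
⊕-cancelˡ _          {zero}     {zero}     _ = refl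
⊕-cancelˡ _          {suc zero} {suc zero} _ = refl
⊕-cancelˡ zero       {zero}     {suc zero} ()
⊕-cancelˡ (suc zero) {zero}     {suc zero} ()
⊕-cancelˡ zero       {suc zero} {zero}     ()
⊕-cancelˡ (suc zero) {suc zero} {zero}     ()

⊕-cancelʳ : ∀ {x y} z → x ⊕ z ≡ y ⊕ z → x ≡ y
⊕-cancelʳ zero eq = eq
⊕-cancelʳ {zero}     {zero}     (suc zero) _ = refl
⊕-cancelʳ {suc zero} {suc zero} (suc zero) _ = refl
⊕-cancelʳ {zero}     {suc zero} (suc zero) ()
⊕-cancelʳ {suc zero} {zero}     (suc zero) ()

-- The parity-check code

parity : ∀ {m} → Word 2 m → Fin 2
parity {zero}  x = zero
parity {suc m} x = x zero ⊕ parity (x ∘ suc)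

parity-cong : ∀ {m} {x y : Word 2 m} → (∀ i → x i ≡ y i) → parity x ≡ parity y
parity-cong {zero}  x≗y = refl
parity-cong {suc m} x≗y = cong₂ _⊕_ (x≗y zero) (parity-cong (x≗y ∘ suc))

-- `⊕` cancels on both sides, so a single differing letter cannot be compensated by equal ones.
parity-flip : ∀ {m} {x y : Word 2 m} i → x i ≢ y i → (∀ j → j ≢ i → x j ≡ y j) → parity x ≢ parity y
parity-flip {x = x} {y} zero x≢y rest eq = x≢y (⊕-cancelʳ (parity (y ∘ suc))
  (trans (cong (x zero ⊕_) (sym (parity-cong λ j → rest (suc j) λ ()))) eq))
parity-flip {x = x} {y} (suc i) x≢y rest eq = parity-flip i x≢y
  (λ j j≢i → rest (suc j) λ { refl → j≢i refl })
  (⊕-cancelˡ (y zero) (trans (cong (_⊕ parity (x ∘ suc)) (sym (rest zero λ ()))) eq))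

codeword : ∀ {m} → Word 2 m → Word 2 (suc m)
codeword x = parity x ∷ᵂ x

-- If the words differ in one letter only, the parity letter supplies the second difference. The two
-- positions become the middle vertices of two bicoloured paths.
codeword-distance : ∀ {m} {x y : Word 2 m} → ¬ (∀ i → x i ≡ y i) →
  ∃[ i ] ∃[ j ] (i ≢ j × codeword x i ≢ codeword y i × codeword x j ≢ codeword y j)
codeword-distance {m} {x} {y} x≗̸y with ¬∀⟶∃¬ m _ (λ i → x i ≟ y i) x≗̸y
... | i , xi≢yi with any? (λ j → ¬? (j ≟ i) ×-dec ¬? (x j ≟ y j))
...   | yes (j , j≢i , xj≢yj) = suc i , suc j , (λ { refl → j≢i refl }) , xi≢yi , xj≢yj
...   | no  none = suc i , zero , (λ ()) , xi≢yi , parity-flip i xi≢yi agree-off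
  where
  agree-off : ∀ j → j ≢ i → x j ≡ y j
  agree-off j j≢i with x j ≟ y j
  ... | yes eq = eq
  ... | no neq = ⊥-elim (none (j , j≢i , neq))

binary : ∀ {n} m → .(n ≤ 2 ^ m) → Fin n → Word 2 m
binary m n≤2^m v = finToFun (inject≤ v n≤2^m)

binary-injective : ∀ {n} m .(n≤2^m : n ≤ 2 ^ m) {u v} → (∀ i → binary m n≤2^m u i ≡ binary m n≤2^m v i) → u ≡ v
binary-injective m n≤2^m {u} {v} eq = toℕ-injective (begin
  toℕ u                                  ≡⟨ toℕ-inject≤ u n≤2^m ⟨
  toℕ (inject≤ u n≤2^m)                  ≡⟨ cong toℕ (funToFin-finToFin {m} {2} _) ⟨
  toℕ (funToFin (binary m n≤2^m u))        ≡⟨ cong toℕ (funToFin-cong eq) ⟩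
  toℕ (funToFin (binary m n≤2^m v))        ≡⟨ cong toℕ (funToFin-finToFin {m} {2} _) ⟩
  toℕ (inject≤ v n≤2^m)                  ≡⟨ toℕ-inject≤ v n≤2^m ⟩
  toℕ v                                  ∎)
  where
  open ≡-Reasoning
  funToFin-cong : ∀ {m r} {f g : Fin m → Fin r} → (∀ i → f i ≡ g i) → funToFin f ≡ funToFin g
  funToFin-cong {zero}  f≗g = refl
  funToFin-cong {suc m} f≗g = cong₂ combine (f≗g zero) (funToFin-cong (f≗g ∘ suc))

-- Colouring the core by a path

isOne : ℕ → Fin 2
isOne (suc zero) = suc zero
isOne _          = zero

-- Adjacency in the infinite path 0 - 1 - 2 - ….
near : ℕ → ℕ → Fin 2
near zero    b       = isOne b
near (suc a) zero    = isOne (suc a)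
near (suc a) (suc b) = near a b

near-sym : ∀ a b → near a b ≡ near b a
near-sym zero    zero    = refl
near-sym zero    (suc b) = refl
near-sym (suc a) zero    = refl
near-sym (suc a) (suc b) = near-sym a b

near-suc : ∀ a → near a (suc a) ≡ suc zero
near-suc zero    = refl
near-suc (suc a) = near-suc a

near-far : ∀ {a b} → suc (suc a) ≤ b → near a b ≡ zero
near-far {zero}  (s≤s (s≤s _)) = refl
near-far {suc a} (s≤s a+2≤b)   = near-far a+2≤b

0≢1 : ∀ {x y : Fin 2} → x ≡ zero → y ≡ suc zero → x ≢ y
0≢1 refl refl ()

1≢0 : ∀ {x y : Fin 2} → x ≡ suc zero → y ≡ zero → x ≢ y
1≢0 refl refl ()

-- Take for `p` a path neighbour of just one of `a` and `b`: the predecessor of `a`, else the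
-- successor of `b`, else 1. In the last case `b` is the last position, and `4 ≤ s` keeps it at
-- distance at least 2 from 1.
near-separates : ∀ {a b s} → 4 ≤ s → a < b → b < s →
  ∃[ p ] (p < s × p ≢ a × p ≢ b × near a p ≢ near p b)
near-separates {suc a} {b} 4≤s a<b b<s =
  a , <-trans (<-trans (n<1+n a) a<b) b<s , (λ ()) , <⇒≢ (<-trans (n<1+n a) a<b) ,
  1≢0 (trans (near-sym (suc a) a) (near-suc a)) (near-far a<b)
near-separates {zero} {b} {s} 4≤s 0<b b<s with suc b <? s
... | yes 1+b<s = suc b , 1+b<s , (λ ()) , (λ ()) ,
  0≢1 (near-far (s≤s 0<b)) (trans (near-sym (suc b) b) (near-suc b))
... | no  1+b≮s = 1 , ≤-trans (s≤s (s≤s z≤n)) 4≤s , (λ ()) , <⇒≢ (≤-trans (s≤s (s≤s z≤n)) 3≤b) ,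
  1≢0 refl (near-far 3≤b)
  where
  3≤b : 3 ≤ b
  3≤b = ≤-pred (≤-trans 4≤s (≮⇒≥ 1+b≮s))

-- Total in the position, so that `colour` can read a label at `toℕ` of a vertex without a bound;
-- past the end the value is `zero`.
letter : ∀ {m} → Word 2 m → ℕ → Fin 2
letter {zero}  x _       = zero
letter {suc m} x zero    = x zero
letter {suc m} x (suc p) = letter (x ∘ suc) p

letter-toℕ : ∀ {m} (x : Word 2 m) i → letter x (toℕ i) ≡ x i
letter-toℕ x zero    = refl
letter-toℕ x (suc i) = letter-toℕ (x ∘ suc) i

-- The vertices below 5 + m form a clique, the core, in which colour 1 marks the edges of the
-- path 0 - 1 - 2 - …; every other vertex is joined exactly to the core, with colours spelling
-- its label. The leading 1s make a label disagree with every row of the core colouring.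
module Construction {n m : ℕ} (n≤2^m : n ≤ 2 ^ m) (size≤n : 5 + m ≤ n) where

  -- Four leading 1s, one parity letter and `m` binary digits.
  size : ℕ
  size = 5 + m

  core : Fin n → Bool
  core i = ⌊ toℕ i <? size ⌋

  label : Fin n → Word 2 size
  label v = suc zero ∷ᵂ suc zero ∷ᵂ suc zero ∷ᵂ suc zero ∷ᵂ codeword (binary m n≤2^m v)

  edge : Relation n
  edge i j = not ⌊ i ≟ j ⌋ ∧ (core i ∨ core j)

  colour : Fin n → Fin n → Fin 2
  colour i j with core i | core j
  ... | true  | true  = near (toℕ i) (toℕ j)
  ... | true  | false = letter (label j) (toℕ i)
  ... | false | true  = letter (label i) (toℕ j)
  -- A default: no edge joins two vertices outside the core.
  ... | false | false = zero

  edge-sym : ∀ i j → edge i j ≡ edge j i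
  edge-sym i j with i ≟ j | j ≟ i
  ... | yes _    | yes _    = refl
  ... | yes refl | no  i≢i  = contradiction refl i≢i
  ... | no  i≢i  | yes refl = contradiction refl i≢i
  ... | no  _    | no  _    = ∨-comm (core i) (core j)

  edge-irr : ∀ i → edge i i ≡ false
  edge-irr i with i ≟ i
  ... | yes _   = refl
  ... | no  i≢i = contradiction refl i≢i

  colour-sym : ∀ i j → colour i j ≡ colour j i
  colour-sym i j with core i | core j
  ... | true  | true  = near-sym (toℕ i) (toℕ j)
  ... | true  | false = refl
  ... | false | true  = refl
  ... | false | false = refl

  core-edgeˡ : ∀ {i j} → i ≢ j → core i ≡ true → edge i j ≡ true
  core-edgeˡ {i} {j} i≢j ci with i ≟ j
  ... | yes i≡j = contradiction i≡j i≢j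
  ... | no  _   rewrite ci = refl

  core-edgeʳ : ∀ {i j} → i ≢ j → core j ≡ true → edge i j ≡ true
  core-edgeʳ {i} {j} i≢j cj = trans (edge-sym i j) (core-edgeˡ (i≢j ∘ sym) cj)

  vertex : Fin size → Fin n
  vertex p = inject≤ p size≤n

  toℕ-vertex : ∀ p → toℕ (vertex p) ≡ toℕ p
  toℕ-vertex p = toℕ-inject≤ p size≤n

  core-vertex : ∀ p → core (vertex p) ≡ true
  core-vertex p with toℕ (vertex p) <? size
  ... | yes _  = refl
  ... | no  ≮s = contradiction (subst (_< size) (sym (toℕ-vertex p)) (toℕ<n p)) ≮s

  core⇒< : ∀ {v} → core v ≡ true → toℕ v < size
  core⇒< {v} cv with toℕ v <? size
  ... | yes v<s = v<s

  outer≢vertex : ∀ {v} → core v ≡ false → ∀ p → v ≢ vertex p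
  outer≢vertex cv p refl = true≢false (trans (sym (core-vertex p)) cv)

  colour-core : ∀ {u w} → core u ≡ true → core w ≡ true → colour u w ≡ near (toℕ u) (toℕ w)
  colour-core cu cw rewrite cu | cw = refl

  colour-label : ∀ {v} → core v ≡ false → ∀ p → colour v (vertex p) ≡ label v p
  colour-label {v} cv p rewrite cv | core-vertex p | toℕ-vertex p = letter-toℕ (label v) p

  edge-vertex : ∀ {v} → ∀ p → v ≢ vertex p → edge v (vertex p) ≡ true
  edge-vertex p v≢p = core-edgeʳ v≢p (core-vertex p)

  bicoloured : ∀ {u v} p → u ≢ vertex p → v ≢ vertex p → colour u (vertex p) ≢ colour v (vertex p) →
    Bicoloured edge colour u v (vertex p)
  bicoloured {u} {v} p u≢p v≢p differ = edge-vertex p u≢p ,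
    trans (edge-sym _ v) (edge-vertex p v≢p) , λ eq → differ (trans eq (colour-sym (vertex p) v))

  linked-outer : ∀ {u v} → u ≢ v → core u ≡ false → core v ≡ false → Linked edge colour u v
  linked-outer {u} {v} u≢v cu cv with codeword-distance (u≢v ∘ binary-injective m n≤2^m)
  ... | i , j , i≢j , ≢i , ≢j = inj₂ (vertex i′ , vertex j′ , vertices≢ , through i ≢i , through j ≢j)
    where
    -- Shifted past the four leading 1s.
    i′ = suc (suc (suc (suc i)))
    j′ = suc (suc (suc (suc j)))
    vertices≢ : vertex i′ ≢ vertex j′
    vertices≢ eq with inject≤-injective size≤n size≤n i′ j′ eq
    ... | refl = i≢j refl
    through : ∀ i → codeword (binary m n≤2^m u) i ≢ codeword (binary m n≤2^m v) i →
      Bicoloured edge colour u v (vertex (suc (suc (suc (suc i)))))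
    through i ≢i = bicoloured p (outer≢vertex cu p) (outer≢vertex cv p)
      λ eq → ≢i (trans (sym (colour-label cu p)) (trans eq (colour-label cv p)))
      where p = suc (suc (suc (suc i)))

  -- Labels are 1 at positions 0 to 3, and one of these is at distance at least 2 from `a`. Position
  -- 3, taken for `a = 1`, accounts for the fourth leading 1.
  label-mismatch : ∀ v a → ∃[ p ] (label v p ≡ suc zero × a ≢ toℕ p × near a (toℕ p) ≡ zero)
  label-mismatch v zero          = suc (suc zero) , refl , (λ ()) , refl
  label-mismatch v (suc zero)    = suc (suc (suc zero)) , refl , (λ ()) , refl
  label-mismatch v (suc (suc a)) = zero , refl , (λ ()) , refl

  linked-mixed : ∀ {u v} → core u ≡ true → core v ≡ false → Linked edge colour u v
  linked-mixed {u} {v} cu cv = inj₁ (core-edgeˡ u≢v cu , through (label-mismatch v (toℕ u)))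
    where
    u≢v : u ≢ v
    u≢v refl = true≢false (trans (sym cu) cv)
    through : ∃[ p ] (label v p ≡ suc zero × toℕ u ≢ toℕ p × near (toℕ u) (toℕ p) ≡ zero) →
      ∃[ w ] Bicoloured edge colour u v w
    through (p , one , u≢p , zer) = vertex p , bicoloured p
      (λ eq → u≢p (trans (cong toℕ eq) (toℕ-vertex p))) (outer≢vertex cv p)
      (0≢1 (trans (colour-core cu (core-vertex p)) (trans (cong (near (toℕ u)) (toℕ-vertex p)) zer))
           (trans (colour-label cv p) one))

  linked-core : ∀ {u v} → toℕ u < toℕ v → core u ≡ true → core v ≡ true → Linked edge colour u v
  linked-core {u} {v} u<v cu cv with near-separates (s≤s (s≤s (s≤s (s≤s z≤n)))) u<v (core⇒< cv)
  ... | p , p<s , p≢u , p≢v , differ = inj₁ (core-edgeˡ u≢v cu , vertex q , bicoloured q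
    (λ eq → p≢u (sym (trans (cong toℕ eq) q≡p))) (λ eq → p≢v (sym (trans (cong toℕ eq) q≡p)))
    λ eq → differ (trans (sym (row cu)) (trans eq (trans (row cv) (near-sym (toℕ v) p)))))
    where
    q = fromℕ< p<s
    q≡p : toℕ (vertex q) ≡ p
    q≡p = trans (toℕ-vertex q) (toℕ-fromℕ< p<s)
    u≢v : u ≢ v
    u≢v eq = <⇒≢ u<v (cong toℕ eq)
    row : ∀ {w} → core w ≡ true → colour w (vertex q) ≡ near (toℕ w) p
    row {w} cw = trans (colour-core cw (core-vertex q)) (cong (near (toℕ w)) q≡p)

  core-dichotomy : ∀ v → core v ≡ true ⊎ core v ≡ false
  core-dichotomy v with core v
  ... | true  = inj₁ refl
  ... | false = inj₂ refl

  allLinked : AllLinked edge colour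
  allLinked u v u≢v with core-dichotomy u | core-dichotomy v
  ... | inj₂ cu | inj₂ cv = linked-outer u≢v cu cv
  ... | inj₁ cu | inj₂ cv = linked-mixed cu cv
  ... | inj₂ cu | inj₁ cv = linked-sym edge-sym colour-sym (linked-mixed cv cu)
  ... | inj₁ cu | inj₁ cv with <-cmp (toℕ u) (toℕ v)
  ...   | tri< u<v _ _ = linked-core u<v cu cv
  ...   | tri≈ _ u≡v _ = contradiction (toℕ-injective u≡v) u≢v
  ...   | tri> _ _ v<u = linked-sym edge-sym colour-sym (linked-core v<u cv cu)

  -- The core is an initial segment, so the smaller end of every edge lies in it.
  edgeCount≤ : edgeCount edge ≤ size * n
  edgeCount≤ = begin
    edgeCount edge                                ≤⟨ ∑-mono-≤ {n} (λ i → ∑-mono-≤ {n} (bound i)) ⟩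
    ∑[ i < n ] ∑[ j < n ] 𝟙 (core i)              ≡⟨ sum-cong-≗ {n} (λ i → ∑-const n (𝟙 (core i))) ⟩
    ∑[ i < n ] (n * 𝟙 (core i))                   ≡⟨ *-distribˡ-sum {n} n _ ⟨
    n * ∑[ i < n ] 𝟙 (core i)                     ≤⟨ *-monoʳ-≤ n (∑-𝟙<? n size) ⟩
    n * size                                      ≡⟨ *-comm n size ⟩
    size * n                                      ∎
    where
    open ≤-Reasoning
    bound : ∀ i j → 𝟙 (⌊ toℕ i <? toℕ j ⌋ ∧ edge i j) ≤ 𝟙 (core i)
    bound i j with toℕ i <? toℕ j | toℕ i <? size | i ≟ j | toℕ j <? size
    ... | no  _   | _      | _     | _       = z≤n
    ... | yes _   | yes _  | _     | _       = 𝟙≤1 _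
    ... | yes _   | no _   | yes _ | _       = z≤n
    ... | yes _   | no _   | no _  | no _    = z≤n
    ... | yes i<j | no i≮s | no _  | yes j<s = contradiction (<-trans i<j j<s) i≮s
    ∑-𝟙<? : ∀ n s → ∑[ i < n ] 𝟙 ⌊ toℕ i <? s ⌋ ≤ s
    ∑-𝟙<? zero    s       = z≤n
    ∑-𝟙<? (suc n) zero    = ≤-reflexive (trans (∑-const n 0) (*-zeroʳ n))
    ∑-𝟙<? (suc n) (suc s) = s≤s (≤-trans (∑-mono-≤ {n} shift) (∑-𝟙<? n s))
      where
      shift : ∀ (i : Fin n) → 𝟙 ⌊ suc (toℕ i) <? suc s ⌋ ≤ 𝟙 ⌊ toℕ i <? s ⌋
      shift i with toℕ i <? s | suc (toℕ i) <? suc s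
      ... | yes _   | _             = 𝟙≤1 _
      ... | no  _   | no _          = z≤n
      ... | no  i≮s | yes (s≤s i<s) = contradiction i<s i≮s

  attainable : Attainable n (edgeCount edge)
  attainable = admissible⇒attainable (≤-trans (s≤s (s≤s (s≤s z≤n))) size≤n)
    (edge-sym , edge-irr , colour-sym , allLinked , refl)

-- Asymptotics

-- Comparing powers of `n` and 2 stands in for logarithms: here log₂ n < ℓ + 1 is used, and ℓ ≤ log₂
-- n in the next lemma.
n^m≤2^[1+ℓ]m : ∀ {n} ℓ m → n < 2 ^ suc ℓ → n ^ m ≤ 2 ^ (suc ℓ * m)
n^m≤2^[1+ℓ]m ℓ m n<2^ = ≤-trans (^-monoˡ-≤ m (<⇒≤ n<2^)) (≤-reflexive (^-*-assoc 2 (suc ℓ) m))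

2^ℓm≤n^m : ∀ {n} ℓ m → 2 ^ ℓ ≤ n → 2 ^ (ℓ * m) ≤ n ^ m
2^ℓm≤n^m ℓ m 2^≤n = ≤-trans (≤-reflexive (sym (^-*-assoc 2 ℓ m))) (^-monoˡ-≤ m 2^≤n)

-- The hypotheses say that k ≥ (1 - 1/3b)(ℓ + 1) and M ≥ (1 - 1/3b)(1 + M + 2ℓ), where b = 1 + B;
-- their product loses a factor of at most 1 - 2/3b.
density-bound : ∀ {E n k ℓ} M B → k * n * M ≤ E * (1 + M + 2 * k) → k ≤ ℓ →
  (2 + 3 * B) * suc ℓ ≤ (3 + 3 * B) * k → (2 + 3 * B) * (1 + M + 2 * ℓ) ≤ (3 + 3 * B) * M →
  suc ℓ * (B * n) ≤ E * suc B
density-bound {E} {n} {k} {ℓ} M B main k≤ℓ k-large M-large =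
  *-cancelˡ-≤ (9 * suc B) (*-cancelʳ-≤ _ _ (1 + M + 2 * ℓ) (begin
    9 * suc B * (suc ℓ * (B * n)) * (1 + M + 2 * ℓ)
      ≤⟨ *-monoˡ-≤ (1 + M + 2 * ℓ) square ⟩
    (2 + 3 * B) * (2 + 3 * B) * (suc ℓ * n) * (1 + M + 2 * ℓ)
      ≡⟨ regroup (2 + 3 * B) ℓ n (1 + M + 2 * ℓ) ⟩
    (2 + 3 * B) * suc ℓ * ((2 + 3 * B) * (1 + M + 2 * ℓ)) * n
      ≤⟨ *-monoˡ-≤ n (*-mono-≤ k-large M-large) ⟩
    (3 + 3 * B) * k * ((3 + 3 * B) * M) * n
      ≡⟨ regroup′ B k M n ⟩
    9 * suc B * suc B * (k * n * M)
      ≤⟨ *-monoʳ-≤ (9 * suc B * suc B) (≤-trans main (*-monoʳ-≤ E (+-monoʳ-≤ (1 + M) (*-monoʳ-≤ 2 k≤ℓ)))) ⟩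
    9 * suc B * suc B * (E * (1 + M + 2 * ℓ))
      ≡⟨ regroup″ B E (1 + M + 2 * ℓ) ⟩
    9 * suc B * (E * suc B) * (1 + M + 2 * ℓ) ∎))
  where
  open ≤-Reasoning
  regroup : ∀ c ℓ n m → c * c * (suc ℓ * n) * m ≡ c * suc ℓ * (c * m) * n
  regroup = solve-∀
  regroup′ : ∀ B k M n → (3 + 3 * B) * k * ((3 + 3 * B) * M) * n ≡ 9 * suc B * suc B * (k * n * M)
  regroup′ = solve-∀
  regroup″ : ∀ B E m → 9 * suc B * suc B * (E * m) ≡ 9 * suc B * (E * suc B) * m
  regroup″ = solve-∀
  expand : ∀ B ℓ n → (2 + 3 * B) * (2 + 3 * B) * (suc ℓ * n)
    ≡ 9 * suc B * (suc ℓ * (B * n)) + (4 + 3 * B) * (suc ℓ * n)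
  expand = solve-∀
  -- With b = 1 + B this rests on (3b - 1)² ≥ 9b(b - 1), the difference being 3b + 1.
  square : 9 * suc B * (suc ℓ * (B * n)) ≤ (2 + 3 * B) * (2 + 3 * B) * (suc ℓ * n)
  square = ≤-trans (m≤m+n _ _) (≤-reflexive (sym (expand B ℓ n)))

module Lower {n} {α : Relation n} {χ : Fin n → Fin n → Fin 2}
  (α-sym : ∀ i j → α i j ≡ α j i) (α-irr : ∀ i → α i i ≡ false)
  (χ-sym : ∀ i j → χ i j ≡ χ j i) (linked : AllLinked α χ) where

  -- The threshold between low and high degrees is 2 ^ q.
  lower-bound : ∀ B {ℓ q} → 2 ^ ℓ ≤ n → 15 * suc B * q ≤ ℓ → ℓ < 15 * suc B * suc q →
    90 * suc B * suc B * suc q ≤ 2 ^ q → 1 ≤ q → suc ℓ * (B * n) ≤ edgeCount α * suc B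
  lower-bound B {ℓ} {q} 2^ℓ≤n q≤ ℓ< q-large 1≤q = density-bound {E = edgeCount α} {n} M B main (m∸n≤m ℓ (4 * q)) k-large M-large
    where
    open ≤-Reasoning
    -- One less than the threshold: subtracting `k * n` from both sides of `edgeCount-bound` at
    -- `suc M` then leaves `k * n * M`.
    M = 2 ^ q ∸ 1
    1+M≡2^q : suc M ≡ 2 ^ q
    1+M≡2^q = m+[n∸m]≡n (m^n>0 2 q)
    -- For the threshold T = 2^q ≥ 2 one has (1 + T²)T ≤ T⁴ = 2^(4q), so `small` reduces to
    -- `2 ^ ℓ ≤ n`.
    k = ℓ ∸ 4 * q
    4q≤ℓ : 4 * q ≤ ℓ
    4q≤ℓ = ≤-trans (*-monoˡ-≤ q (≤-trans (m≤m+n 4 (11 + 15 * B)) (≤-reflexive (const B)))) q≤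
      where
      const : ∀ B → 4 + (11 + 15 * B) ≡ 15 * suc B
      const = solve-∀
    k+4q≡ℓ : k + 4 * q ≡ ℓ
    k+4q≡ℓ = m∸n+n≡m 4q≤ℓ
    small : (1 + suc M * suc M) * 2 ^ k * suc M ≤ n
    small = begin
      (1 + suc M * suc M) * 2 ^ k * suc M
        ≤⟨ *-monoˡ-≤ (suc M) (*-monoˡ-≤ (2 ^ k) cube) ⟩
      suc M * suc M * suc M * 2 ^ k * suc M
        ≡⟨ collect (suc M) (2 ^ k) ⟩
      2 ^ k * suc M ^ 4
        ≡⟨ cong (2 ^ k *_) (trans (cong (_^ 4) 1+M≡2^q) (^-*-assoc 2 q 4)) ⟩
      2 ^ k * 2 ^ (q * 4)
        ≡⟨ ^-distribˡ-+-* 2 k (q * 4) ⟨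
      2 ^ (k + q * 4)
        ≡⟨ cong (2 ^_) (trans (cong (k +_) (*-comm q 4)) k+4q≡ℓ) ⟩
      2 ^ ℓ
        ≤⟨ 2^ℓ≤n ⟩
      n ∎
      where
      collect : ∀ x y → x * x * x * y * x ≡ y * (x * (x * (x * (x * 1))))
      collect = solve-∀
      2≤1+M : 2 ≤ suc M
      2≤1+M = ≤-trans (^-monoʳ-≤ 2 1≤q) (≤-reflexive (sym 1+M≡2^q))
      cube : 1 + suc M * suc M ≤ suc M * suc M * suc M
      cube = begin
        1 + suc M * suc M              ≤⟨ +-monoˡ-≤ (suc M * suc M) (s≤s z≤n) ⟩
        suc M * suc M + suc M * suc M  ≡⟨ double (suc M * suc M) ⟩
        suc M * suc M * 2              ≤⟨ *-monoʳ-≤ (suc M * suc M) 2≤1+M ⟩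
        suc M * suc M * suc M          ∎
        where
        double : ∀ x → x + x ≡ x * 2
        double = solve-∀
    main : k * n * M ≤ edgeCount α * (1 + M + 2 * k)
    main = +-cancelʳ-≤ (k * n) _ _ (begin
      k * n * M + k * n  ≡⟨ distrib (k * n) M ⟩
      k * n * suc M      ≤⟨ edgeCount-bound α-sym α-irr χ-sym linked (suc M) k small ⟩
      edgeCount α * (1 + M + 2 * k) + k * n ∎)
      where
      distrib : ∀ x y → x * y + x ≡ x * suc y
      distrib = solve-∀
    -- With b = 1 + B and ℓ = k + 4q, it suffices that (3b - 1)(4q + 1) ≤ k. As 4q + 1 ≤ 5q, this
    -- follows from 5(3b - 1)q + 4q ≤ 15bq ≤ ℓ, the source of the constant 15.
    k-large : (2 + 3 * B) * suc ℓ ≤ (3 + 3 * B) * k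
    k-large = begin
      (2 + 3 * B) * suc ℓ
        ≡⟨ cong (λ x → (2 + 3 * B) * suc x) k+4q≡ℓ ⟨
      (2 + 3 * B) * suc (k + 4 * q)
        ≡⟨ expand B k q ⟩
      (2 + 3 * B) * k + ((8 + 12 * B) * q + (2 + 3 * B) * 1)
        ≤⟨ +-monoʳ-≤ ((2 + 3 * B) * k) (+-monoʳ-≤ ((8 + 12 * B) * q) (*-monoʳ-≤ (2 + 3 * B) 1≤q)) ⟩
      (2 + 3 * B) * k + ((8 + 12 * B) * q + (2 + 3 * B) * q)
        ≤⟨ +-monoʳ-≤ ((2 + 3 * B) * k) leftover ⟩
      (2 + 3 * B) * k + k
        ≡⟨ contract B k ⟩
      (3 + 3 * B) * k ∎
      where
      expand : ∀ B k q → (2 + 3 * B) * suc (k + 4 * q) ≡ (2 + 3 * B) * k + ((8 + 12 * B) * q + (2 + 3 * B) * 1)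
      expand = solve-∀
      contract : ∀ B k → (2 + 3 * B) * k + k ≡ (3 + 3 * B) * k
      contract = solve-∀
      leftover : (8 + 12 * B) * q + (2 + 3 * B) * q ≤ k
      leftover = +-cancelʳ-≤ (4 * q) _ _ (begin
        (8 + 12 * B) * q + (2 + 3 * B) * q + 4 * q        ≤⟨ m≤m+n _ q ⟩
        (8 + 12 * B) * q + (2 + 3 * B) * q + 4 * q + q    ≡⟨ total B q ⟩
        15 * suc B * q                                    ≤⟨ q≤ ⟩
        ℓ                                                 ≡⟨ k+4q≡ℓ ⟨
        k + 4 * q                                         ∎)
        where
        total : ∀ B q → (8 + 12 * B) * q + (2 + 3 * B) * q + 4 * q + q ≡ 15 * suc B * q
        total = solve-∀
    -- It suffices that (3b - 1)(1 + 2ℓ) < 2^q. The left side is below 3b · 2(ℓ + 1) ≤ 3b · 2 ·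
    -- 15b(q + 1), the source of the constant 90.
    M-large : (2 + 3 * B) * (1 + M + 2 * ℓ) ≤ (3 + 3 * B) * M
    M-large = begin
      (2 + 3 * B) * (1 + M + 2 * ℓ)
        ≡⟨ expand B M ℓ ⟩
      (2 + 3 * B) * M + (2 + 3 * B) * (1 + 2 * ℓ)
        ≤⟨ +-monoʳ-≤ ((2 + 3 * B) * M) (≤-pred 1+rest≤1+M) ⟩
      (2 + 3 * B) * M + M
        ≡⟨ contract B M ⟩
      (3 + 3 * B) * M ∎
      where
      expand : ∀ B M ℓ → (2 + 3 * B) * (1 + M + 2 * ℓ) ≡ (2 + 3 * B) * M + (2 + 3 * B) * (1 + 2 * ℓ)
      expand = solve-∀
      contract : ∀ B M → (2 + 3 * B) * M + M ≡ (3 + 3 * B) * M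
      contract = solve-∀
      slack : ∀ B ℓ → suc ((2 + 3 * B) * (1 + 2 * ℓ)) + (3 + 3 * B + 2 * ℓ) ≡ 3 * suc B * (2 * suc ℓ)
      slack = solve-∀
      total : ∀ B q → 3 * suc B * (2 * (15 * suc B * suc q)) ≡ 90 * suc B * suc B * suc q
      total = solve-∀
      1+rest≤1+M : suc ((2 + 3 * B) * (1 + 2 * ℓ)) ≤ suc M
      1+rest≤1+M = begin
        suc ((2 + 3 * B) * (1 + 2 * ℓ))        ≤⟨ ≤-trans (m≤m+n _ (3 + 3 * B + 2 * ℓ)) (≤-reflexive (slack B ℓ)) ⟩
        3 * suc B * (2 * suc ℓ)                ≤⟨ *-monoʳ-≤ (3 * suc B) (*-monoʳ-≤ 2 ℓ<) ⟩
        3 * suc B * (2 * (15 * suc B * suc q)) ≡⟨ total B q ⟩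
        90 * suc B * suc B * suc q             ≤⟨ q-large ⟩
        2 ^ q                                  ≡⟨ 1+M≡2^q ⟨
        suc M                                  ∎

-- The constants stay variables here: Agda would otherwise unfold the power of 2 into unary.
module Asymptotics (a B c C q₀ : ℕ) (c≡ : c ≡ 15 * suc B) (C≡ : C ≡ 90 * suc B * suc B)
  (q₀≡ : q₀ ≡ suc (2 * C)) where

  open ≤-Reasoning

  private
    b : ℕ
    b = suc B

    instance
      c≢0 : NonZero c
      c≢0 = subst NonZero (sym c≡) _

  -- Lets ℓ absorb the additive 6 in the core size `6 + ℓ` after multiplication by `b`.
  6b≤cq₀ : 6 * b ≤ c * q₀
  6b≤cq₀ = subst₂ (λ c q → 6 * b ≤ c * q) (sym c≡) (sym q₀≡)
    (≤-trans (*-monoˡ-≤ b (m≤m+n 6 9)) (m≤m*n (15 * b) (suc (2 * C))))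

  -- Both inequalities are proved with relative error 1/b; a numerator `suc a` only weakens them, as
  -- `b ∸ suc a` is `B ∸ a ≤ B`.
  estimates : ∀ {n t} ℓ .{{_ : NonZero n}} → 2 ^ ℓ ≤ n → n < 2 ^ suc ℓ → c * q₀ ≤ ℓ →
    IsT₂ n 2 t → t ≤ (6 + ℓ) * n →
    n ^ ((b ∸ suc a) * n) ≤ 2 ^ (t * b) × 2 ^ (t * b) ≤ n ^ ((b + suc a) * n)
  estimates {n} {t} ℓ 2^ℓ≤n n<2^1+ℓ cq₀≤ℓ t-min t≤ = lower , upper
    where
    -- Makes the degree threshold `2 ^ q` roughly the power n^(1/c).
    q = ℓ / c
    cq≤ℓ : c * q ≤ ℓ
    cq≤ℓ = ≤-trans (≤-reflexive (*-comm c q)) (m/n*n≤m ℓ c)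
    ℓ<c[1+q] : ℓ < c * suc q
    ℓ<c[1+q] = begin-strict
      ℓ                              ≡⟨ m≡m%n+[m/n]*n ℓ c ⟩
      ℓ % c + q * c    <⟨ +-monoˡ-< (q * c) (m%n<n ℓ c) ⟩
      c + q * c          ≡⟨ *-comm (suc q) c ⟩
      c * suc q                 ∎
    q₀≤q : q₀ ≤ q
    q₀≤q = ≤-pred (*-cancelˡ-< c q₀ (suc q) (≤-<-trans cq₀≤ℓ ℓ<c[1+q]))
    2C<q : suc (2 * C) ≤ q
    2C<q = subst (_≤ q) q₀≡ q₀≤q
    [1+ℓ]Bn≤tb : suc ℓ * (B * n) ≤ t * b
    [1+ℓ]Bn≤tb with attainable⇒admissible (proj₁ t-min)
    ... | α , χ , α-sym , α-irr , χ-sym , linked , count = subst (λ e → suc ℓ * (B * n) ≤ e * b) count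
      (Lower.lower-bound α-sym α-irr χ-sym linked B 2^ℓ≤n
        (subst (λ c → c * q ≤ ℓ) c≡ cq≤ℓ) (subst (λ c → ℓ < c * suc q) c≡ ℓ<c[1+q])
        (subst (λ C → C * suc q ≤ 2 ^ q) C≡ (linear≤2^ C q 2C<q)) (≤-trans (s≤s z≤n) 2C<q))
    lower : n ^ ((b ∸ suc a) * n) ≤ 2 ^ (t * b)
    lower = begin
      n ^ ((B ∸ a) * n)     ≤⟨ ^-monoʳ-≤ n (*-monoˡ-≤ n (m∸n≤m B a)) ⟩
      n ^ (B * n)           ≤⟨ n^m≤2^[1+ℓ]m ℓ (B * n) n<2^1+ℓ ⟩
      2 ^ (suc ℓ * (B * n)) ≤⟨ ^-monoʳ-≤ 2 [1+ℓ]Bn≤tb ⟩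
      2 ^ (t * b)           ∎
    tb≤ℓ[b+1]n : t * b ≤ ℓ * ((b + 1) * n)
    tb≤ℓ[b+1]n = begin
      t * b                     ≤⟨ *-monoˡ-≤ b t≤ ⟩
      (6 + ℓ) * n * b           ≡⟨ expand ℓ n b ⟩
      (6 * b + ℓ * b) * n       ≤⟨ *-monoˡ-≤ n (+-monoˡ-≤ (ℓ * b) (≤-trans 6b≤cq₀ cq₀≤ℓ)) ⟩
      (ℓ + ℓ * b) * n           ≡⟨ contract ℓ n b ⟩
      ℓ * ((b + 1) * n)         ∎
      where
      expand : ∀ ℓ n b → (6 + ℓ) * n * b ≡ (6 * b + ℓ * b) * n
      expand = solve-∀
      contract : ∀ ℓ n b → (ℓ + ℓ * b) * n ≡ ℓ * ((b + 1) * n)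
      contract = solve-∀
    upper : 2 ^ (t * b) ≤ n ^ ((b + suc a) * n)
    upper = begin
      2 ^ (t * b)             ≤⟨ ^-monoʳ-≤ 2 tb≤ℓ[b+1]n ⟩
      2 ^ (ℓ * ((b + 1) * n)) ≤⟨ 2^ℓm≤n^m ℓ ((b + 1) * n) 2^ℓ≤n ⟩
      n ^ ((b + 1) * n)       ≤⟨ ^-monoʳ-≤ n (*-monoˡ-≤ n (+-monoʳ-≤ b (s≤s z≤n))) ⟩
      n ^ ((b + suc a) * n)   ∎

  bounds : ∀ {n} ℓ .{{_ : NonZero n}} → 2 ^ ℓ ≤ n → n < 2 ^ suc ℓ → c * q₀ ≤ ℓ →
    ∃[ t ] (IsT₂ n 2 t ×
    n ^ ((b ∸ suc a) * n) ≤ 2 ^ (t * b) ×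
    2 ^ (t * b) ≤ n ^ ((b + suc a) * n))
  bounds {n} ℓ 2^ℓ≤n n<2^1+ℓ cq₀≤ℓ =
    let t , t-min , t≤ = t₂-exists (≤-trans (m≤m+n 3 (3 + ℓ)) size≤n) attainable
    in t , t-min , estimates ℓ 2^ℓ≤n n<2^1+ℓ cq₀≤ℓ t-min (≤-trans t≤ edgeCount≤)
    where
    size≤n : 6 + ℓ ≤ n
    size≤n = begin
      6 + ℓ     ≤⟨ +-monoˡ-≤ ℓ (≤-trans (≤-trans (m≤m*n 6 b) 6b≤cq₀) cq₀≤ℓ) ⟩
      ℓ + ℓ     ≡⟨ cong (ℓ +_) (+-identityʳ ℓ) ⟨
      2 * ℓ     ≤⟨ 2n≤2^n ℓ ⟩
      2 ^ ℓ     ≤⟨ 2^ℓ≤n ⟩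
      n         ∎
    -- ℓ + 1 binary digits distinguish all vertices, so the core has 5 + (ℓ + 1) vertices.
    open Construction {n} {suc ℓ} (<⇒≤ n<2^1+ℓ) size≤n using (edgeCount≤; attainable)

  eventually : ∃[ N ] ∀ (n : ℕ) → N ≤ n →
    ∃[ t ] (IsT₂ n 2 t ×
    n ^ ((b ∸ suc a) * n) ≤ 2 ^ (t * b) ×
    2 ^ (t * b) ≤ n ^ ((b + suc a) * n))
  -- From this `N` on, `c * q₀ ≤ ℓ`: otherwise `2 ^ suc ℓ ≤ N ≤ n`.
  eventually = 2 ^ (c * q₀) , large
    where
    large : ∀ n → 2 ^ (c * q₀) ≤ n → _
    large zero      N≤0 = contradiction N≤0 (<⇒≱ (m^n>0 2 (c * q₀)))
    large (suc n-1) N≤n =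
      let ℓ , 2^ℓ≤n , n<2^1+ℓ = ⌊log₂⌋-bounds n-1
      in bounds ℓ 2^ℓ≤n n<2^1+ℓ (≮⇒≥ λ ℓ< → <⇒≱ n<2^1+ℓ (≤-trans (^-monoʳ-≤ 2 ℓ<) N≤n))

-- With ε = a/b, taking log₂ and dividing by b gives (1 - ε) n log₂ n ≤ t ≤ (1 + ε) n log₂ n for all
-- large n. For a ≥ b the truncated subtraction makes the lower bound trivial.
theorem3p1 : ∀ (a b : ℕ) → 0 < a → 0 < b →
    ∃[ N ] ∀ (n : ℕ) → N ≤ n →
    ∃[ t ] (IsT₂ n 2 t ×
    n ^ ((b ∸ a) * n) ≤ 2 ^ (t * b) ×
    2 ^ (t * b) ≤ n ^ ((b + a) * n))
theorem3p1 (suc a) (suc B) _ _ = Asymptotics.eventually a B _ _ _ refl refl refl
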